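{- Let $k,n\geq 1$ be integers and let $T\in\mathcal{F}(C_{k;n})$ be a sequence of length $$|T|\geq \begin{cases}\left\lfloor\frac{(\lceil k/n\rceil+1)\,n}{2}\right\rfloor, & \text{if } k>n;\\[4pt] \left\lfloor\frac{n}{2}\right\rfloor+1, & \text{otherwise.}\end{cases}$$ Then $T$ is idempotent-sum free if and only if one of the following two conditions holds: (i) $k>n$, the sequence $\mathop{\bullet}_{a\mid T}\mathrm{ind}(a)\in\mathcal{F}(\mathbb{Z})$ is $1$-smooth, and $\sum_{a\mid T}\mathrm{ind}(a)\leq \lceil k/n\rceil n-1$; (ii) $k\leq n$, and the sequence $\mathop{\bullet}_{a\mid T}(\mathrm{ind}(a)+n\mathbb{Z})\in\mathcal{F}(\mathbb{Z}/n\mathbb{Z})$ is $g$-smooth for some $g\in\mathbb{Z}/n\mathbb{Z}$ with $\mathrm{ord}(g)=n$.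
   Context: Cyclic semigroups. $C_{k;n}=\langle s\rangle$ denotes the finite cyclic semigroup (written additively) with generator $s$, index $k$ and period $n$: $k$ is the least positive integer such that $ks=ts$ for some positive integer $t\neq k$, and $n$ is the least positive integer with $(k+n)s=ks$. So $C_{k;n}=\{s,2s,\ldots,(k+n-1)s\}$ has $k+n-1$ elements; for $k=1$ it is the cyclic group of order $n$. The generator $s$ is fixed, and for $a\in C_{k;n}$, $\mathrm{ind}(a)$ is the least positive integer $t$ with $ts=a$. An element $e$ is idempotent if $e+e=e$. Sequences. For a set $\mathcal{S}$, $\mathcal{F}(\mathcal{S})$ is the set of finite unordered sequences (multisets) of terms from $\mathcal{S}$, repetition allowed; $|T|$ is the number of terms of $T$ counted with multiplicity. For a commutative semigroup $\mathcal{S}$ and $T\in\mathcal{F}(\mathcal{S})$, $\Sigma(T)$ is the set of all sums of nonempty subsequences of $T$. Sums $\sum_{a\mid T}$ and products $\mathop{\bullet}_{a\mid T}$ are over the terms of $T$ with multiplicity; $\mathop{\bullet}_{a\mid T} f(a)$ denotes the sequence obtained from $T$ by applying $f$ to each term. $T$ is idempotent-sum free if no nonempty subsequence of $T$ has an idempotent as its sum. Smooth sequences. Let $G$ be an abelian group and $g\in G$. A nonempty sequence $T\in\mathcal{F}(G)$ is $g$-smooth if it can be written $T=(n_1g)\cdot\ldots\cdot(n_\ell g)$ with integers $1=n_1\leq\cdots\leq n_\ell$, $N=n_1+\cdots+n_\ell<\mathrm{ord}(g)$ and $\Sigma(T)=\{g,2g,\ldots,Ng\}$. In particular (taking $G=\mathbb{Z}$,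 $g=1$, of infinite order), a nonempty sequence $T$ of positive integers is $1$-smooth if and only if $\Sigma(T)=[1,\sum_{a\mid T}a]$, where $[a,b]$ denotes an interval of integers. -}

module Defs where

open import Algebra.Bundles using (CommutativeSemigroup; AbelianGroup)
open import Data.Bool.Base using (if_then_else_)
open import Data.Integer.Base as ℤ using (ℤ; +_)
import Data.Integer.Properties as ℤ
import Data.Integer.Divisibility.Signed as ℤ∣
open import Data.Integer.Solver using (module +-*-Solver)
open import Data.List.Base using (List; _∷_; map)
open import Data.List.NonEmpty.Base using (List⁺; foldr₁; toList)
open import Data.List.Relation.Binary.Sublist.Propositional using (_⊆_)
import Data.List.Relation.Binary.Permutation.Setoid as Permutation
import Data.List.Relation.Unary.Sorted.TotalOrder as SortedOrder
open import Data.Nat.Base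
  using (ℕ; zero; suc; pred; NonZero; _+_; _*_; _∸_; _≤_; _<_; s≤s; s≤s⁻¹)
open import Data.Nat.DivMod using (_/_; _%_; m≡m%n+[m/n]*n; m%n<n)
open import Data.Nat.Induction using (<-rec)
open import Data.Nat.ListAction using (sum)
open import Data.Nat.Properties
open import Data.Product.Base using (∃; Σ; _×_; _,_; proj₁; proj₂)
open import Data.Sum.Base using (inj₁; inj₂)
open import Function.Bundles using (_⇔_)
open import Level using (Level; _⊔_; 0ℓ) renaming (suc to lsuc)
open import Relation.Binary.PropositionalEquality as ≡
  using (_≡_; _≢_; refl; cong; subst; subst₂)
open import Relation.Nullary using (¬_; Dec; yes; no; does; contradiction)
open import Relation.Unary using (Pred; Decidable)
import Algebra.Definitions
import Algebra.Definitions.RawMonoid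

private
  variable
    p : Level

Pred⁺ : (p : Level) → Set (lsuc p)
Pred⁺ p = (t : ℕ) .{{_ : NonZero t}} → Set p

∃⁺ : Pred⁺ p → Set p
∃⁺ P = ∃ λ t → Σ (NonZero t) λ t≢0 → P t {{t≢0}}

LeastPositive : Pred⁺ p → Pred⁺ p
LeastPositive P m = P m × (∀ t .{{_ : NonZero t}} → P t → m ≤ t)

+-nonZero : ∀ m n .{{_ : NonZero m}} → NonZero (m + n)
+-nonZero (suc m) n = _

-- The ceiling of the rational number k / n.
⌈_/_⌉ : (k n : ℕ) .{{_ : NonZero n}} → ℕ
⌈ k / n ⌉ = (k + (n ∸ 1)) / n

-- An unordered sequence is represented by a list; all notions below are
-- invariant under permutations of the list.

module SemigroupSequences {c ℓ : Level} (S : CommutativeSemigroup c ℓ) where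
  open CommutativeSemigroup S
  open Algebra.Definitions _≈_ using (_IdempotentOn_)

  infixr 8 _·_
  _·_ : (t : ℕ) .{{_ : NonZero t}} → Carrier → Carrier
  suc zero    · x = x
  suc (suc t) · x = x ∙ (suc t · x)

  sum⁺ : List⁺ Carrier → Carrier
  sum⁺ = foldr₁ _∙_

  Sums : List Carrier → Pred Carrier (c ⊔ ℓ)
  Sums T x = ∃ λ U → toList U ⊆ T × sum⁺ U ≈ x

  IdempotentSumFree : List Carrier → Set (c ⊔ ℓ)
  IdempotentSumFree T = ∀ x → Sums T x → ¬ (_∙_ IdempotentOn x)

module GroupSequences {c ℓ : Level} (G : AbelianGroup c ℓ) where
  open AbelianGroup G
  open Algebra.Definitions.RawMonoid rawMonoid using () renaming (_×_ to _·_) public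
  open SemigroupSequences commutativeSemigroup using (Sums)
  open Permutation setoid using (_↭_)
  open SortedOrder ≤-totalOrder using (Sorted)

  HasOrder : Carrier → Pred⁺ ℓ
  HasOrder g = LeastPositive (λ t → t · g ≈ ε)

  -- The strict inequality N < ord(g), where ord(g) may be infinite.
  _<ord_ : ℕ → Carrier → Set ℓ
  N <ord g = ∀ t .{{_ : NonZero t}} → t · g ≈ ε → N < t

  -- The coefficients n₁ ≤ … ≤ n_ℓ are 1 ∷ ns; as n₁ = 1 they are all
  -- positive, so natural numbers suffice.
  record Smooth (g : Carrier) (T : List Carrier) : Set (c ⊔ ℓ) where
    field
      ns : List ℕ

    coefficients : List ℕ
    coefficients = 1 ∷ ns

    N : ℕ
    N = sum coefficients

    field
      sorted : Sorted coefficients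
      terms  : T ↭ map (_· g) coefficients
      N<ord  : N <ord g
      sums   : ∀ x → Sums T x ⇔ (∃ λ j → 1 ≤ j × j ≤ N × x ≈ j · g)

ℤ-group : AbelianGroup 0ℓ 0ℓ
ℤ-group = ℤ.+-0-abelianGroup

-- ℤ/nℤ has the integers as representatives, with congruence modulo n as
-- its equality; the residue class a + nℤ is represented by a.
ℤ/_ℤ : ℕ → AbelianGroup 0ℓ 0ℓ
ℤ/ n ℤ = record
  { Carrier = ℤ
  ; _≈_ = _≈_
  ; _∙_ = ℤ._+_
  ; ε = ℤ.0ℤ
  ; _⁻¹ = ℤ.-_
  ; isAbelianGroup = record
    { isGroup = record
      { isMonoid = record
        { isSemigroup = record
          { isMagma = record
            { isEquivalence = record
              { refl = λ {x} → ≡⇒≈ {x} refl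
              ; sym = λ {x} {y} x≈y → subst (+ n ℤ∣.∣_) (neg-sub x y) (ℤ∣.∣m⇒∣-m x≈y)
              ; trans = λ {x} {y} {z} x≈y y≈z →
                  subst (+ n ℤ∣.∣_) (add-sub x y z) (ℤ∣.∣m∣n⇒∣m+n x≈y y≈z)
              }
            ; ∙-cong = λ {x} {y} {u} {v} x≈y u≈v →
                subst (+ n ℤ∣.∣_) (sub-add x y u v) (ℤ∣.∣m∣n⇒∣m+n x≈y u≈v)
            }
          ; assoc = λ x y z → ≡⇒≈ (ℤ.+-assoc x y z)
          }
        ; identity = (λ x → ≡⇒≈ (ℤ.+-identityˡ x)) , (λ x → ≡⇒≈ (ℤ.+-identityʳ x))
        }
      ; inverse = (λ x → ≡⇒≈ (ℤ.+-inverseˡ x)) , (λ x → ≡⇒≈ (ℤ.+-inverseʳ x))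
      ; ⁻¹-cong = λ {x} {y} x≈y → subst (+ n ℤ∣.∣_) (neg-neg x y) (ℤ∣.∣m⇒∣-m x≈y)
      }
    ; comm = λ x y → ≡⇒≈ (ℤ.+-comm x y)
    }
  }
  where
  open +-*-Solver

  _≈_ : ℤ → ℤ → Set
  x ≈ y = + n ℤ∣.∣ (x ℤ.- y)

  ≡⇒≈ : ∀ {x y} → x ≡ y → x ≈ y
  ≡⇒≈ {x} refl = subst (+ n ℤ∣.∣_) (≡.sym (ℤ.+-inverseʳ x)) (ℤ∣.divides ℤ.0ℤ refl)

  neg-sub : ∀ x y → ℤ.- (x ℤ.- y) ≡ y ℤ.- x
  neg-sub = solve 2 (λ x y → :- (x :- y) := y :- x) refl

  add-sub : ∀ x y z → (x ℤ.- y) ℤ.+ (y ℤ.- z) ≡ x ℤ.- z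
  add-sub = solve 3 (λ x y z → (x :- y) :+ (y :- z) := x :- z) refl

  sub-add : ∀ x y u v → (x ℤ.- y) ℤ.+ (u ℤ.- v) ≡ (x ℤ.+ u) ℤ.- (y ℤ.+ v)
  sub-add = solve 4 (λ x y u v → (x :- y) :+ (u :- v) := (x :+ u) :- (y :+ v)) refl

  neg-neg : ∀ x y → ℤ.- (x ℤ.- y) ≡ (ℤ.- x) ℤ.- (ℤ.- y)
  neg-neg = solve 2 (λ x y → :- (x :- y) := (:- x) :- (:- y)) refl

private
  module _ {P : Pred ℕ p} (P? : Decidable P) where

    Least : Set p
    Least = ∃ λ m → P m × (∀ t → P t → m ≤ t)

    least : ∀ t → P t → Least
    least = <-rec (λ t → P t → Least) step
      where
      step : ∀ t → (∀ {u} → u < t → P u → Least) → P t → Least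
      step t rec Pt with anyUpTo? P? t
      ... | yes (u , u<t , Pu) = rec u<t Pu
      ... | no none = t , Pt , λ u Pu → ≮⇒≥ λ u<t → none (u , u<t , Pu)

-- C_{k;n} = ⟨s⟩ is characterised up to isomorphism by these properties;
-- commutativity follows from cyclicity, so bundling it loses nothing.
record CyclicSemigroup (c ℓ : Level) (k n : ℕ) .{{_ : NonZero k}} .{{_ : NonZero n}}
       : Set (lsuc (c ⊔ ℓ)) where
  field
    commutativeSemigroup : CommutativeSemigroup c ℓ

  open CommutativeSemigroup commutativeSemigroup public
  open SemigroupSequences commutativeSemigroup public

  field
    s         : Carrier
    generated : ∀ a → ∃⁺ λ t → t · s ≈ a
    index     : LeastPositive (λ m → ∃⁺ λ t → t ≢ m × m · s ≈ t · s) k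
    period    : LeastPositive (λ m → _·_ (k + m) {{+-nonZero k m}} s ≈ k · s) n

-- The least positive t with t · s ≈ a exists constructively: whether
-- t · s ≈ u · s holds is decidable, since for t < u it means that
-- k ≤ t and n divides u ∸ t.  In this proof, indices are shifted by one.
module _ {c ℓ : Level} {k n : ℕ} .{{_ : NonZero k}} .{{_ : NonZero n}}
         (C : CyclicSemigroup c ℓ k n) where
  open CyclicSemigroup C hiding (refl)

  private
    E : ℕ → ℕ → Set ℓ
    E t u = suc t · s ≈ suc u · s

    E-refl : ∀ t → E t t
    E-refl _ = CommutativeSemigroup.refl commutativeSemigroup

    shift : ∀ j t u → E t u → E (j + t) (j + u)
    shift zero    t u e = e
    shift (suc j) t u e = ∙-congˡ (shift j t u e)

    shiftʳ : ∀ j t u → E t u → E (t + j) (u + j)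
    shiftʳ j t u e = subst₂ E (+-comm j t) (+-comm j u) (shift j t u e)

    module _ (k′ : ℕ) (k≡ : k ≡ suc k′) where

      periodic : E (k′ + n) k′
      periodic = go k≡ (proj₁ period)
        where
        go : ∀ {k} .{{_ : NonZero k}} → k ≡ suc k′ → _·_ (k + n) {{+-nonZero k n}} s ≈ k · s → E (k′ + n) k′
        go refl e = e

      period-least : ∀ r .{{_ : NonZero r}} → E (k′ + r) k′ → n ≤ r
      period-least r e = proj₂ period r (go k≡ e)
        where
        go : ∀ {k} .{{_ : NonZero k}} → k ≡ suc k′ → E (k′ + r) k′ → _·_ (k + r) {{+-nonZero k r}} s ≈ k · s
        go refl e = e

      periods : ∀ q → E (k′ + q * n) k′
      periods zero    = subst (λ t → E t k′) (≡.sym (+-identityʳ k′)) (E-refl k′)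
      periods (suc q) = trans
        (subst (λ t → E t (k′ + q * n)) (+-assoc k′ n (q * n)) (shiftʳ (q * n) (k′ + n) k′ periodic))
        (periods q)

      k′≤ : ∀ t d .{{_ : NonZero d}} → E t (t + d) → k′ ≤ t
      k′≤ t d e = s≤s⁻¹ (subst (_≤ suc t) k≡ (proj₂ index (suc t) (suc (t + d) , _ , ne , e)))
        where
        ne : suc (t + d) ≢ suc t
        ne eq = m+1+n≢m t (≡.trans (cong (_+_ t) (suc-pred d)) (suc-injective eq))

      divisible : ∀ t d → k′ ≤ t → E t (t + d) → d % n ≡ 0
      divisible t d k′≤t e with d % n in eq
      ... | zero = refl
      ... | r@(suc _) = contradiction (period-least r e₃) (<⇒≱ (subst (_< n) eq (m%n<n d n)))
        where
        x : ℕ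
        x = (k′ + t * n) ∸ t

        x+t : x + t ≡ k′ + t * n
        x+t = m∸n+n≡m (≤-trans (m≤m*n t n) (m≤n+m (t * n) k′))

        e₁ : E (k′ + t * n) (k′ + t * n + d)
        e₁ = subst₂ E x+t (≡.trans (≡.sym (+-assoc x t d)) (cong (_+ d) x+t)) (shift x t (t + d) e)

        e₂ : E (k′ + d) k′
        e₂ = trans (shiftʳ d k′ (k′ + t * n) (sym (periods t))) (trans (sym e₁) (periods t))

        d≡ : d / n * n + r ≡ d
        d≡ = ≡.trans (+-comm (d / n * n) r)
          (≡.trans (cong (_+ d / n * n) (≡.sym eq)) (≡.sym (m≡m%n+[m/n]*n d n)))

        e₃ : E (k′ + r) k′
        e₃ = trans (sym (subst (λ z → E z (k′ + r))
          (≡.trans (+-assoc k′ (d / n * n) r) (cong (_+_ k′) d≡))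
          (shiftʳ r (k′ + d / n * n) k′ (periods (d / n))))) e₂

      E+? : ∀ t d → Dec (E t (t + d))
      E+? t zero = yes (subst (E t) (≡.sym (+-identityʳ t)) (E-refl t))
      E+? t d@(suc _) with k′ ≤? t | d % n ≟ 0
      ... | no k′≰t  | _         = no λ e → k′≰t (k′≤ t d e)
      ... | yes k′≤t | no d%n≢0  = no λ e → d%n≢0 (divisible t d k′≤t e)
      ... | yes k′≤t | yes d%n≡0 = yes (sym (subst₂ E
              (≡.trans (≡.sym (+-assoc y k′ (d / n * n)))
                (≡.trans (cong (_+ d / n * n) y+k′) (cong (_+_ t) (≡.sym d≡))))
              y+k′
              (shift y (k′ + d / n * n) k′ (periods (d / n)))))
        where
        y : ℕ
        y = t ∸ k′

        y+k′ : y + k′ ≡ t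
        y+k′ = m∸n+n≡m k′≤t

        d≡ : d ≡ d / n * n
        d≡ = ≡.trans (m≡m%n+[m/n]*n d n) (cong (_+ d / n * n) d%n≡0)

      E? : ∀ t u → Dec (E t u)
      E? t u with ≤-total t u
      ... | inj₁ t≤u = subst (λ z → Dec (E t z)) (m+[n∸m]≡n t≤u) (E+? t (u ∸ t))
      ... | inj₂ u≤t with subst (λ z → Dec (E u z)) (m+[n∸m]≡n u≤t) (E+? u (t ∸ u))
      ...   | yes e = yes (sym e)
      ...   | no ¬e = no λ e → ¬e (sym e)

    leastMultiple : ∀ a → ∃ λ m → suc m · s ≈ a × (∀ t → suc t · s ≈ a → m ≤ t)
    leastMultiple a with generated a
    ... | suc t , _ , e = least dec t e
      where
      dec : Decidable (λ u → suc u · s ≈ a)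
      dec u with E? (pred k) (≡.sym (suc-pred k)) u t
      ... | yes e′ = yes (trans e′ e)
      ... | no ¬e′ = no λ e″ → ¬e′ (trans e″ (sym e))

  ind : Carrier → ℕ
  ind a = suc (proj₁ (leastMultiple a))

  ind-least : ∀ a → LeastPositive (λ t → t · s ≈ a) (ind a)
  ind-least a with leastMultiple a
  ... | m , e , min = e , λ where (suc t) e′ → s≤s (min t e′)

module _ (k n : ℕ) .{{_ : NonZero n}} where

  minLength : ℕ
  minLength = if does (n <? k)
    then (⌈ k / n ⌉ + 1) * n / 2
    else n / 2 + 1

-- For k ≤ n the theorem is the Savchev–Chen structure theorem in ℤ/nℤ.  Let Σ₀(T) be the set of all
-- subsequence sums, 0 included, of a zero-sum free sequence T in an abelian group.  If |Σ₀(T)| < 2|T|,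
-- then T is g-smooth for some g, by induction on |T|:
-- * If |Σ₀(T∖a)| < 2|T∖a| for some term a, then T∖a is g-smooth, with Σ₀(T∖a) = {0, g, …, Ng}.  Either
--   a = xg with 1 ≤ x ≤ N + 1, and T is g-smooth, or a + Σ₀(T∖a) is disjoint from Σ₀(T∖a), and then
--   |Σ₀(T)| ≥ 2(N + 1) ≥ 2|T|.
-- * Otherwise Σ₀(T) has just one element more than Σ₀(T∖a), for every term a; it is the sum σ of T.
--   So Σ₀(T∖a) = B = Σ₀(T) ∖ {σ} for all a, and the symmetry y ↦ σ − a − y of B forces all terms to
--   be equal.
-- If T has more than n/2 terms in ℤ/nℤ, then |Σ₀(T)| ≤ n < 2|T|, and N < ord(g) leaves only ord(g) = n.
--
-- For k > n put K = ⌈k/n⌉; the sum of indices of a nonempty subsequence must not be a multiple of n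
-- that is ≥ Kn.  Split T into U, with sum divisible by n and hence ≤ (K − 1)n, and V, zero-sum free
-- modulo n and hence with fewer than n terms.  Then U has average less than 2, so it is 1-smooth and
-- some subsequence of U has sum σ(T) mod n.  Removing it from T leaves a multiple of n, which is at most
-- (K − 1)n; so σ(T) < Kn ≤ 2|T|, whence T is 1-smooth.

module Submission where

open import Defs
open import Algebra.Bundles using (AbelianGroup)
import Algebra.Definitions
open import Data.Fin.Base using (Fin; zero; suc)
import Data.Fin.Properties as Fin
open import Data.Integer.Base as ℤ using (ℤ; +_; 1ℤ)
import Data.Integer.Divisibility.Signed as ℤ∣
open import Data.Integer.DivMod using (_%ℕ_; _/ℕ_; n%ℕd<d; a≡a%ℕn+[a/ℕn]*n)
import Data.Integer.Properties as ℤ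
open import Data.List.Base
  using (List; []; _∷_; [_]; _++_; length; map; foldr; lookup; removeAt; deduplicate; applyUpTo)
import Data.List.Membership.Setoid as Membership
import Data.List.Membership.Setoid.Properties as MembershipProperties
open import Data.List.NonEmpty.Base as List⁺ using (toList)
open import Data.List.Properties
  using (length-++; length-map; length-applyUpTo; map-id; map-++; map-∘; map-cong)
open import Data.List.Relation.Binary.Permutation.Propositional as ↭ using (_↭_)
import Data.List.Relation.Binary.Permutation.Propositional.Properties as ↭
import Data.List.Relation.Binary.Permutation.Setoid as Permutation
import Data.List.Relation.Binary.Permutation.Setoid.Properties as PermutationProperties
open import Data.List.Relation.Binary.Pointwise.Base using (Pointwise; []; _∷_)
open import Data.List.Relation.Binary.Sublist.Propositional using (_⊆_; []; _∷_; _∷ʳ_)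
import Data.List.Relation.Binary.Sublist.Propositional.Properties as ⊆
open import Data.List.Relation.Unary.All as All using (All; []; _∷_)
import Data.List.Relation.Unary.All.Properties as All
open import Data.List.Relation.Unary.AllPairs using ([]; _∷_)
open import Data.List.Relation.Unary.Any as Any using (here; there; any?)
import Data.List.Relation.Unary.Any.Properties as Any
import Data.List.Relation.Unary.Sorted.TotalOrder as SortedOrder
open import Data.List.Relation.Unary.Sorted.TotalOrder.Properties using (Sorted⇒AllPairs)
import Data.List.Relation.Unary.Unique.DecSetoid.Properties as DecUnique
import Data.List.Relation.Unary.Unique.Setoid as Unique
import Data.List.Relation.Unary.Unique.Setoid.Properties as UniqueProperties
import Data.List.Sort as Sort
open import Data.Nat.Base hiding (_⊔_)
open import Data.Nat.DivMod
open import Data.Nat.Divisibility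
open import Data.Nat.GCD
open import Data.Nat.ListAction using (sum)
open import Data.Nat.ListAction.Properties using (sum-↭; sum-++)
open import Data.Nat.Properties
open import Data.Product.Base using (_×_; _,_; ∃; proj₁; proj₂)
open import Data.Sum.Base using (_⊎_; inj₁; inj₂)
open import Function.Base using (_∘_; id; case_of_)
open import Function.Bundles using (_⇔_; mk⇔; Equivalence)
open import Level using (Level; _⊔_)
open import Relation.Binary.Bundles using (Setoid; DecSetoid)
open import Relation.Binary.Definitions using (Decidable)
open import Relation.Binary.PropositionalEquality as ≡ using (_≡_; _≢_; refl; cong; subst)
import Relation.Binary.Reasoning.Setoid as SetoidReasoning
open import Relation.Nullary using (¬_; Dec; yes; no; contradiction)
open import Relation.Nullary.Decidable using (map′; dec-true; dec-false)

open SortedOrder ≤-totalOrder using (Sorted)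
open Sort ≤-decTotalOrder using (sort; sort-↭; sort-↗)

private
  variable
    i : Level
    I : Set i

-- Permutations and repetition-free lists over a setoid.

module _ {c ℓ} (S : Setoid c ℓ) where
  open Setoid S
  open Permutation S using (↭-prep; ↭-swap; ↭-refl; ↭-trans) renaming (_↭_ to _↭ₛ_)
  open Membership S using (_∈_)
  open Unique S using (Unique)

  ↭-removeAt : ∀ xs (i : Fin (length xs)) → xs ↭ₛ lookup xs i ∷ removeAt xs i
  ↭-removeAt (x ∷ xs) zero    = ↭-refl
  ↭-removeAt (x ∷ xs) (suc i) = ↭-trans (↭-prep x (↭-removeAt xs i)) (↭-swap x _ ↭-refl)

  map-↭ : {w : I → Carrier} {xs ys : List I} → xs ↭ ys → map w xs ↭ₛ map w ys
  map-↭ ↭.refl         = ↭-refl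
  map-↭ (↭.prep x p)   = ↭-prep _ (map-↭ p)
  map-↭ (↭.swap x y p) = ↭-swap _ _ (map-↭ p)
  map-↭ (↭.trans p q)  = ↭-trans (map-↭ p) (map-↭ q)

  -- Pigeonhole by deletion: the partner of the head is removed from `ys`, and the tail keeps its
  -- partners because none of its elements equals the head.
  Unique-length-≤ : ∀ {xs} ys → Unique xs → All (_∈ ys) xs → length xs ≤ length ys
  Unique-length-≤ ys []          []         = z≤n
  Unique-length-≤ ys (x∉xs ∷ xs!) (x∈ys ∷ xs⊆ys) = subst (suc _ ≤_)
    (≡.sym (PermutationProperties.xs↭ys⇒|xs|≡|ys| S ys↭))
    (s≤s (Unique-length-≤ _ xs! (All.map drop-head (All.zip (x∉xs , xs⊆ys)))))
    where
    ys↭ = ↭-removeAt ys (Any.index x∈ys)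

    drop-head : ∀ {z} → ¬ _ ≈ z × z ∈ ys → z ∈ removeAt ys (Any.index x∈ys)
    drop-head (x≉z , z∈ys) with PermutationProperties.Any-resp-↭ S (λ x≈y z≈x → trans z≈x x≈y) ys↭ z∈ys
    ... | here z≈y  = contradiction (trans (Any.lookup-index x∈ys) (sym z≈y)) x≉z
    ... | there z∈  = z∈

positive⇒length≤sum : ∀ {ns} → All (1 ≤_) ns → length ns ≤ sum ns
positive⇒length≤sum []       = z≤n
positive⇒length≤sum (p ∷ ps) = +-mono-≤ p (positive⇒length≤sum ps)

-- Subsequence sums and zero-sum free sequences in an abelian group.

module SubsequenceSums {c ℓ} (G : AbelianGroup c ℓ) where
  open AbelianGroup G renaming (refl to ≈-refl)
  open GroupSequences G
  open SemigroupSequences commutativeSemigroup using (Sums; sum⁺)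
  open import Algebra.Properties.Group group using (∙-cancelˡ; identityʳ-unique; inverseʳ-unique)
  open import Algebra.Properties.CommutativeSemigroup commutativeSemigroup using (x∙yz≈y∙xz)
  open import Algebra.Properties.Monoid.Mult monoid using (×-congˡ; ×-homo-+; ×-homo-1)
  open Permutation setoid using (↭-sym; ↭-prep; ↭-trans; ↭-refl) renaming (_↭_ to _↭ₛ_)

  -- SubSum T x stands for x ∈ Σ₀(T).
  data SubSum : List Carrier → Carrier → Set (c ⊔ ℓ) where
    empty : ∀ {x} → x ≈ ε → SubSum [] x
    skip  : ∀ {a T x} → SubSum T x → SubSum (a ∷ T) x
    take  : ∀ {a T x y} → SubSum T y → x ≈ a ∙ y → SubSum (a ∷ T) x

  -- Every nonempty subsequence is charged to its first chosen term, so that adding or dropping the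
  -- head leaves the conditions on the other terms untouched.
  data ZeroSumFree : List Carrier → Set (c ⊔ ℓ) where
    []  : ZeroSumFree []
    _∷_ : ∀ {a T} → (∀ {y} → SubSum T y → ¬ a ∙ y ≈ ε) → ZeroSumFree T → ZeroSumFree (a ∷ T)

  total : List Carrier → Carrier
  total = foldr _∙_ ε

  SubSum-resp-≈ : ∀ {T x y} → x ≈ y → SubSum T x → SubSum T y
  SubSum-resp-≈ x≈y (empty x≈ε)  = empty (trans (sym x≈y) x≈ε)
  SubSum-resp-≈ x≈y (skip p)     = skip (SubSum-resp-≈ x≈y p)
  SubSum-resp-≈ x≈y (take p x≈)  = take p (trans (sym x≈y) x≈)

  SubSum-resp-↭ : ∀ {T U x} → T ↭ₛ U → SubSum T x → SubSum U x
  SubSum-resp-↭ (Permutation.refl T≋U) p = pointwise T≋U p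
    where
    pointwise : ∀ {T U x} → Pointwise _≈_ T U → SubSum T x → SubSum U x
    pointwise []        (empty x≈ε) = empty x≈ε
    pointwise (_ ∷ T≋U) (skip p)    = skip (pointwise T≋U p)
    pointwise (e ∷ T≋U) (take p x≈) = take (pointwise T≋U p) (trans x≈ (∙-congʳ e))
  SubSum-resp-↭ (Permutation.prep _ T↭U) (skip p)    = skip (SubSum-resp-↭ T↭U p)
  SubSum-resp-↭ (Permutation.prep e T↭U) (take p x≈) = take (SubSum-resp-↭ T↭U p) (trans x≈ (∙-congʳ e))
  SubSum-resp-↭ (Permutation.swap _ _ T↭U) (skip (skip p)) = skip (skip (SubSum-resp-↭ T↭U p))
  SubSum-resp-↭ (Permutation.swap _ e T↭U) (skip (take p x≈)) =
    take (skip (SubSum-resp-↭ T↭U p)) (trans x≈ (∙-congʳ e))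
  SubSum-resp-↭ (Permutation.swap e _ T↭U) (take (skip p) x≈) =
    skip (take (SubSum-resp-↭ T↭U p) (trans x≈ (∙-congʳ e)))
  SubSum-resp-↭ (Permutation.swap e f T↭U) (take (take p y≈) x≈) =
    take (take (SubSum-resp-↭ T↭U p) ≈-refl)
      (trans x≈ (trans (∙-cong e (trans y≈ (∙-congʳ f))) (x∙yz≈y∙xz _ _ _)))
  SubSum-resp-↭ (Permutation.trans T↭U U↭V) p = SubSum-resp-↭ U↭V (SubSum-resp-↭ T↭U p)

  -- The definition looks at the first chosen term, which a swap can change: a sum that uses both
  -- swapped terms is then charged to the other one.
  ZeroSumFree-resp-↭ : ∀ {T U} → T ↭ₛ U → ZeroSumFree T → ZeroSumFree U
  ZeroSumFree-resp-↭ (Permutation.refl T≋U) zf = pointwise T≋U zf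
    where
    pointwise : ∀ {T U} → Pointwise _≈_ T U → ZeroSumFree T → ZeroSumFree U
    pointwise []        []       = []
    pointwise (e ∷ T≋U) (f ∷ zf) =
      (λ p q → f (SubSum-resp-↭ (↭-sym (Permutation.refl T≋U)) p) (trans (∙-congʳ e) q))
      ∷ pointwise T≋U zf
  ZeroSumFree-resp-↭ (Permutation.prep e T↭U) (f ∷ zf) =
    (λ p q → f (SubSum-resp-↭ (↭-sym T↭U) p) (trans (∙-congʳ e) q)) ∷ ZeroSumFree-resp-↭ T↭U zf
  ZeroSumFree-resp-↭ (Permutation.swap {x = x} {y} {x′} {y′} e₁ e₂ T↭U) (f ∷ g ∷ zf) =
    (λ { (skip p) q → g (SubSum-resp-↭ (↭-sym T↭U) p) (trans (∙-congʳ e₂) q)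
       ; (take {y = u} p y≈) q → f (take (SubSum-resp-↭ (↭-sym T↭U) p) ≈-refl)
           (trans (trans (∙-congʳ e₁) (trans (x∙yz≈y∙xz x′ y u) (∙-cong e₂ (sym y≈)))) q) })
    ∷ (λ p q → f (skip (SubSum-resp-↭ (↭-sym T↭U) p)) (trans (∙-congʳ e₁) q))
    ∷ ZeroSumFree-resp-↭ T↭U zf
  ZeroSumFree-resp-↭ (Permutation.trans T↭U U↭V) zf = ZeroSumFree-resp-↭ U↭V (ZeroSumFree-resp-↭ T↭U zf)

  total-++ : ∀ T U → total (T ++ U) ≈ total T ∙ total U
  total-++ []      U = sym (identityˡ _)
  total-++ (_ ∷ T) U = trans (∙-congˡ (total-++ T U)) (sym (assoc _ _ _))

  SubSum-ε : ∀ T → SubSum T ε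
  SubSum-ε []      = empty ≈-refl
  SubSum-ε (_ ∷ T) = skip (SubSum-ε T)

  SubSum-total : ∀ T → SubSum T (total T)
  SubSum-total []      = empty ≈-refl
  SubSum-total (_ ∷ T) = take (SubSum-total T) ≈-refl

  -- The terms left out sum to `y`. This is the symmetry x ↦ σ(T) - x of Σ₀(T).
  SubSum-complement : ∀ {T x} → SubSum T x → ∃ λ y → SubSum T y × x ∙ y ≈ total T
  SubSum-complement (empty x≈ε) = ε , empty ≈-refl , trans (identityʳ _) x≈ε
  SubSum-complement (skip p) with SubSum-complement p
  ... | y , q , xy≈ = _ , take q ≈-refl , trans (x∙yz≈y∙xz _ _ _) (∙-congˡ xy≈)
  SubSum-complement (take p x≈) with SubSum-complement p
  ... | y , q , xy≈ = _ , skip q , trans (∙-congʳ x≈) (trans (assoc _ _ _) (∙-congˡ xy≈))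

  SubSum-++ : ∀ {T U x y} → SubSum T x → SubSum U y → SubSum (T ++ U) (x ∙ y)
  SubSum-++ (empty x≈ε) q = SubSum-resp-≈ (trans (sym (identityˡ _)) (∙-congʳ (sym x≈ε))) q
  SubSum-++ (skip p)    q = skip (SubSum-++ p q)
  SubSum-++ (take p x≈) q = take (SubSum-++ p q) (trans (∙-congʳ x≈) (assoc _ _ _))

  -- The complement in T of such a subsequence would have a sum y with a + y = 0.
  total-new : ∀ {a T} → ZeroSumFree (a ∷ T) → ¬ SubSum T (total (a ∷ T))
  total-new (f ∷ _) p with SubSum-complement p
  ... | y , q , eq = f q (identityʳ-unique _ _
          (trans (x∙yz≈y∙xz _ _ _) (trans (sym (assoc _ _ _)) eq)))

  -- The weights `w` keep the origin of each term, so a sum in the group leads back to a subsequence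
  -- of the original sequence, for instance one in the semigroup.
  SubSum⇒⊆ : (w : I → Carrier) (T : List I) {x : Carrier} → SubSum (map w T) x →
             ∃ λ U → U ⊆ T × total (map w U) ≈ x
  SubSum⇒⊆ w []      (empty x≈ε) = [] , [] , sym x≈ε
  SubSum⇒⊆ w (a ∷ T) (skip p) with SubSum⇒⊆ w T p
  ... | U , U⊆T , eq = U , a ∷ʳ U⊆T , eq
  SubSum⇒⊆ w (a ∷ T) (take p x≈) with SubSum⇒⊆ w T p
  ... | U , U⊆T , eq = a ∷ U , refl ∷ U⊆T , trans (∙-congˡ eq) (sym x≈)

  ⊆⇒SubSum : ∀ {U T} → U ⊆ T → SubSum T (total U)
  ⊆⇒SubSum []           = empty ≈-refl
  ⊆⇒SubSum (_ ∷ʳ U⊆T)   = skip (⊆⇒SubSum U⊆T)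
  ⊆⇒SubSum (refl ∷ U⊆T) = take (⊆⇒SubSum U⊆T) ≈-refl

  sum⁺≈total : ∀ x U → sum⁺ (x List⁺.∷ U) ≈ total (x ∷ U)
  sum⁺≈total x []      = sym (identityʳ x)
  sum⁺≈total x (y ∷ U) = ∙-congˡ (sum⁺≈total y U)

  ZeroSumFree⁺ : (w : I → Carrier) (T : List I) →
                 (∀ a U → a ∷ U ⊆ T → ¬ total (map w (a ∷ U)) ≈ ε) → ZeroSumFree (map w T)
  ZeroSumFree⁺ w []      h = []
  ZeroSumFree⁺ w (a ∷ T) h =
    (λ p q → case SubSum⇒⊆ w T p of λ { (U , U⊆T , eq) → h a U (refl ∷ U⊆T) (trans (∙-congˡ eq) q) })
    ∷ ZeroSumFree⁺ w T (λ b U b∷U⊆T → h b U (a ∷ʳ b∷U⊆T))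

  ZeroSumFree-++ʳ : ∀ T {U} → ZeroSumFree (T ++ U) → ZeroSumFree U
  ZeroSumFree-++ʳ []      zf       = zf
  ZeroSumFree-++ʳ (_ ∷ T) (_ ∷ zf) = ZeroSumFree-++ʳ T zf

  -- The complement `V` is recorded as well, since `zero-sum-split` redistributes both parts.
  SubSum-split : (w : I → Carrier) (T : List I) {x : Carrier} → SubSum (map w T) x →
                 ∃ λ U → ∃ λ V → T ↭ U ++ V × total (map w U) ≈ x
  SubSum-split w []      (empty x≈ε) = [] , [] , ↭.refl , sym x≈ε
  SubSum-split w (a ∷ T) (skip p) with SubSum-split w T p
  ... | U , V , T↭ , eq = U , a ∷ V , ↭.trans (↭.prep a T↭) (↭.↭-sym (↭.shift a U V)) , eq
  SubSum-split w (a ∷ T) (take p x≈) with SubSum-split w T p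
  ... | U , V , T↭ , eq = a ∷ U , V , ↭.prep a T↭ , trans (∙-congˡ eq) (sym x≈)

  ZeroSumFree⇒Sums≉ε : ∀ {T x} → ZeroSumFree T → Sums T x → ¬ x ≈ ε
  ZeroSumFree⇒Sums≉ε zf (y List⁺.∷ U , y∷U⊆T , eq) x≈ε =
    go zf y∷U⊆T (trans (sym (sum⁺≈total y U)) (trans eq x≈ε))
    where
    go : ∀ {T} → ZeroSumFree T → y ∷ U ⊆ T → ¬ total (y ∷ U) ≈ ε
    go (_ ∷ zf) (_ ∷ʳ y∷U⊆T)  = go zf y∷U⊆T
    go (f ∷ _)  (refl ∷ U⊆T) = f (⊆⇒SubSum U⊆T)

  Sums⇒SubSum : ∀ {T x} → Sums T x → SubSum T x
  Sums⇒SubSum (y List⁺.∷ U , y∷U⊆T , eq) =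
    SubSum-resp-≈ (trans (sym (sum⁺≈total y U)) eq) (⊆⇒SubSum y∷U⊆T)

  SubSum⇒Sums : ∀ {T x} → ¬ x ≈ ε → SubSum T x → Sums T x
  SubSum⇒Sums {T} {x} x≉ε p with SubSum⇒⊆ id T (≡.subst (λ U → SubSum U x) (≡.sym (map-id T)) p)
  ... | []    , U⊆T , eq = contradiction (sym eq) x≉ε
  ... | y ∷ U , U⊆T , eq = (y List⁺.∷ U) , U⊆T ,
    trans (sum⁺≈total y U) (≡.subst (λ V → total V ≈ x) (map-id (y ∷ U)) eq)

  -- Coefficient lists whose multiples of g fill an interval, and smoothness.

  Full : Carrier → List ℕ → Set (c ⊔ ℓ)
  Full g ns = ∀ j → j ≤ sum ns → SubSum (map (_· g) ns) (j · g)

  Full-[] : ∀ g → Full g []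
  Full-[] g zero _ = empty ≈-refl

  ·-split : ∀ g {m n} → m ≤ n → n · g ≈ m · g ∙ (n ∸ m) · g
  ·-split g {m} {n} m≤n = trans (×-congˡ (≡.sym (m+[n∸m]≡n m≤n))) (×-homo-+ g m (n ∸ m))

  -- With S the sum of `ns`, the intervals [0, S] and [x, x + S] leave no gap, because x ≤ S + 1.
  Full-∷ : ∀ {g ns x} → Full g ns → x ≤ suc (sum ns) → Full g (x ∷ ns)
  Full-∷ {g} {ns} {x} full x≤ j j≤ with j ≤? sum ns
  ... | yes j≤S = skip (full j j≤S)
  ... | no  j≰S = take (full (j ∸ x) (m≤n+o⇒m∸n≤o j x j≤)) (·-split g (≤-trans x≤ (≰⇒> j≰S)))

  Full-resp-↭ : ∀ {g ms ns} → ms ↭ ns → Full g ms → Full g ns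
  Full-resp-↭ ms↭ns full j j≤ = 
    SubSum-resp-↭ (map-↭ setoid ms↭ns) (full j (subst (j ≤_) (≡.sym (sum-↭ ms↭ns)) j≤))

  -- As long as a coefficient x ≥ 2 remains, it is removed: the sum drops by at least 2, so the
  -- hypothesis survives. The l others sum to at least l and to at most 2l + 1 - x, so x ≤ l + 1,
  -- and x can be put back without a gap. Once none remains, all coefficients are at most 1.
  short⇒Full : ∀ {g} ns → All (1 ≤_) ns → sum ns < 2 * length ns → Full g ns
  short⇒Full {g} ns = go (length ns) ns refl
    where
    go : ∀ m ns → length ns ≡ m → All (1 ≤_) ns → sum ns < 2 * length ns → Full g ns
    go zero    []          _    _  _ = Full-[] g
    go (suc m) ns@(_ ∷ _) |ns| ps sum< with any? (2 ≤?_) ns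
    ... | no ¬2≤ = ones ns (All.map (λ 2≰ → s≤s⁻¹ (≰⇒> 2≰)) (All.¬Any⇒All¬ ns ¬2≤))
      where
      ones : ∀ ns → All (_≤ 1) ns → Full g ns
      ones []       []       = Full-[] g
      ones (n ∷ ns) (p ∷ ps) = Full-∷ {ns = ns} (ones ns ps) (≤-trans p (s≤s z≤n))
    ... | yes 2≤ with lookup ns (Any.index 2≤) | Any.lookup-result 2≤ | removeAt ns (Any.index 2≤)
                    | ↭.↭ₛ⇒↭ (↭-removeAt (≡.setoid ℕ) ns (Any.index 2≤))
    ...   | x | 2≤x | ns′ | ns↭ = Full-resp-↭ (↭.↭-sym ns↭)
      (Full-∷ {ns = ns′} (go m ns′ (suc-injective (≡.trans (≡.sym |ns|≡) |ns|)) ps′ sum′<)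
        (≤-trans x≤ (s≤s (positive⇒length≤sum ps′))))
      where
      |ns|≡ = ↭.↭-length ns↭
      ps′ = All.tail (↭.All-resp-↭ ns↭ ps)
      l = length ns′

      sum≤ : x + sum ns′ < 2 + 2 * l
      sum≤ = ≡.subst₂ _<_ (sum-↭ ns↭) (≡.trans (cong (2 *_) |ns|≡) (*-suc 2 l)) sum<

      sum′< : sum ns′ < 2 * l
      sum′< = +-cancelˡ-< 2 _ _ (≤-<-trans (+-monoˡ-≤ (sum ns′) 2≤x) sum≤)

      x≤ : x ≤ suc l
      x≤ = +-cancelʳ-≤ l x (suc l) (≤-trans (+-monoʳ-≤ x (positive⇒length≤sum ps′))
        (≤-trans (s≤s⁻¹ sum≤) (≤-reflexive (cong (λ m → suc (l + m)) (+-identityʳ l)))))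

  SubSum-multiples : ∀ {g} ns {x} → SubSum (map (_· g) ns) x → ∃ λ j → j ≤ sum ns × x ≈ j · g
  SubSum-multiples []       (empty x≈ε) = 0 , z≤n , x≈ε
  SubSum-multiples (n ∷ ns) (skip p) with SubSum-multiples ns p
  ... | j , j≤ , eq = j , ≤-trans j≤ (m≤n+m _ n) , eq
  SubSum-multiples {g} (n ∷ ns) (take p x≈) with SubSum-multiples ns p
  ... | j , j≤ , eq = n + j , +-monoʳ-≤ n j≤ , trans x≈ (trans (∙-congˡ eq) (sym (×-homo-+ g n j)))

  -- Suppose tg = 0 with 0 < t ≤ x + S, where S is the sum of `ns`. For x ≤ t, the zero sum xg + (t
  -- - x)g uses the term xg; for t < x, the inequality t ≤ S contradicts the order bound.
  <ord-∷ : ∀ {g ns x} → ZeroSumFree (map (_· g) (x ∷ ns)) → Full g ns → sum ns <ord g →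
           x ≤ suc (sum ns) → sum (x ∷ ns) <ord g
  <ord-∷ {g} {ns} {x} (f ∷ _) full S<ord x≤ t t·g≈ε = ≰⇒> λ t≤ → case x ≤? t of λ where
    (yes x≤t) → f (full (t ∸ x) (m≤n+o⇒m∸n≤o t x t≤)) (trans (sym (·-split g x≤t)) t·g≈ε)
    (no  x≰t) → <⇒≱ (S<ord t t·g≈ε) (s≤s⁻¹ (≤-trans (≰⇒> x≰t) x≤))

  record UnsortedSmooth (g : Carrier) (T : List Carrier) : Set (c ⊔ ℓ) where
    field
      ns       : List ℕ
      positive : All (1 ≤_) ns
      terms    : T ↭ₛ map (_· g) ns
      sum<ord  : sum ns <ord g
      full     : Full g ns

    length-terms : length T ≡ length ns
    length-terms = ≡.trans (PermutationProperties.xs↭ys⇒|xs|≡|ys| setoid terms) (length-map _ ns)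

    length≤sum : length T ≤ sum ns
    length≤sum = subst (_≤ sum ns) (≡.sym length-terms) (positive⇒length≤sum positive)

  open UnsortedSmooth

  UnsortedSmooth-resp-↭ : ∀ {g T U} → T ↭ₛ U → UnsortedSmooth g T → UnsortedSmooth g U
  UnsortedSmooth-resp-↭ T↭U sm = record
    { ns = ns sm ; positive = positive sm ; terms = ↭-trans (↭-sym T↭U) (terms sm)
    ; sum<ord = sum<ord sm ; full = full sm }

  UnsortedSmooth-[] : ∀ g → UnsortedSmooth g []
  UnsortedSmooth-[] g = record
    { ns = [] ; positive = [] ; terms = ↭-refl ; sum<ord = λ t _ → >-nonZero⁻¹ t ; full = Full-[] g }

  UnsortedSmooth-∷ : ∀ {g a T x} (sm : UnsortedSmooth g T) → ZeroSumFree (a ∷ T) →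
                     1 ≤ x → x ≤ suc (sum (ns sm)) → a ≈ x · g → UnsortedSmooth g (a ∷ T)
  UnsortedSmooth-∷ sm zf 1≤x x≤ a≈ = record
    { ns       = _ ∷ ns sm
    ; positive = 1≤x ∷ positive sm
    ; terms    = Permutation.prep a≈ (terms sm)
    ; sum<ord  = <ord-∷ {ns = ns sm}
        (ZeroSumFree-resp-↭ (Permutation.prep a≈ (terms sm)) zf) (full sm) (sum<ord sm) x≤
    ; full     = Full-∷ {ns = ns sm} (full sm) x≤
    }

  constant⇒UnsortedSmooth : ∀ {g T} → All (_≈ g) T → ZeroSumFree T → UnsortedSmooth g T
  constant⇒UnsortedSmooth []        []          = UnsortedSmooth-[] _
  constant⇒UnsortedSmooth (e ∷ es) zf@(_ ∷ zf′) =
    UnsortedSmooth-∷ (constant⇒UnsortedSmooth es zf′) zf (s≤s z≤n) (s≤s z≤n) (trans e (sym (×-homo-1 _)))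

  -- Sorting must bring a coefficient 1 to the front: g is a sum, and coefficients that are all at
  -- least 2 produce only jg with j ≠ 1 and j ≤ N, none of which equals g, because N is below the
  -- order.
  UnsortedSmooth⇒Smooth : ∀ {g T} → ZeroSumFree T → 0 < length T → UnsortedSmooth g T → Smooth g T
  UnsortedSmooth⇒Smooth {g} {T} zf 0<|T| sm = go (sort (ns sm)) (sort-↭ (ns sm)) (sort-↗ (ns sm))
    where
    N = sum (ns sm)

    1≤N : 1 ≤ N
    1≤N = ≤-trans 0<|T| (length≤sum sm)

    -- If no coefficient were 1, then g could not be a subsequence sum.
    multiples≢1 : ∀ ns {x} → All (2 ≤_) ns → SubSum (map (_· g) ns) x →
                  ∃ λ j → j ≤ sum ns × j ≢ 1 × x ≈ j · g
    multiples≢1 []       _        (empty x≈ε) = 0 , z≤n , (λ ()) , x≈ε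
    multiples≢1 (n ∷ ns) (_ ∷ ps) (skip p) with multiples≢1 ns ps p
    ... | j , j≤ , j≢1 , eq = j , ≤-trans j≤ (m≤n+m _ n) , j≢1 , eq
    multiples≢1 (n ∷ ns) (2≤n ∷ ps) (take p x≈) with SubSum-multiples ns p
    ... | j , j≤ , eq = n + j , +-monoʳ-≤ n j≤ , (λ e → <⇒≢ (≤-trans 2≤n (m≤m+n n j)) (≡.sym e))
        , trans x≈ (trans (∙-congˡ eq) (sym (×-homo-+ g n j)))

    some-1 : ¬ All (2 ≤_) (ns sm)
    some-1 ps with multiples≢1 (ns sm) ps (full sm 1 1≤N)
    ... | zero        , _  , _   , eq = <⇒≱ (sum<ord sm 1 eq) 1≤N
    ... | suc zero    , _  , 1≢1 , _  = 1≢1 refl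
    ... | suc (suc j) , j≤ , _   , eq =
      <⇒≱ (sum<ord sm (suc j) (sym (∙-cancelˡ g _ _ eq))) (≤-trans (n≤1+n _) j≤)

    head-≤ : ∀ {m ms} → Sorted (m ∷ ms) → All (m ≤_) ms
    head-≤ sorted with m≤ ∷ _ ← Sorted⇒AllPairs ≤-totalOrder sorted = m≤

    go : ∀ ms → ms ↭ ns sm → Sorted ms → Smooth g T
    go [] p _ = contradiction (subst (1 ≤_) (≡.sym (sum-↭ p)) 1≤N) λ ()
    go (zero ∷ ms) p _ with () ∷ _ ← ↭.All-resp-↭ (↭.↭-sym p) (positive sm)
    go (suc (suc m) ∷ ms) p sorted = contradiction
      (↭.All-resp-↭ p (All.map (≤-trans (s≤s (s≤s z≤n))) (≤-refl {x = suc (suc m)} ∷ head-≤ sorted))) some-1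
    go (1 ∷ ms) p sorted = record
      { ns     = ms
      ; sorted = sorted
      ; terms  = ↭-trans (terms sm) (map-↭ setoid (↭.↭-sym p))
      ; N<ord  = λ t eq → subst (_< t) (≡.sym sum-p) (sum<ord sm t eq)
      ; sums   = λ x → mk⇔ to from
      }
      where
      sum-p : sum (1 ∷ ms) ≡ N
      sum-p = sum-↭ p

      to : ∀ {x} → Sums T x → ∃ λ j → 1 ≤ j × j ≤ sum (1 ∷ ms) × x ≈ j · g
      to Σx with SubSum-multiples (ns sm) (SubSum-resp-↭ (terms sm) (Sums⇒SubSum Σx))
      ... | zero  , _  , eq = contradiction eq (ZeroSumFree⇒Sums≉ε zf Σx)
      ... | suc j , j≤ , eq = suc j , s≤s z≤n , subst (suc j ≤_) (≡.sym sum-p) j≤ , eq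

      from : ∀ {x} → (∃ λ j → 1 ≤ j × j ≤ sum (1 ∷ ms) × x ≈ j · g) → Sums T x
      from (suc j , _ , j≤ , eq) = SubSum⇒Sums
        (λ x≈ε → <⇒≱ (sum<ord sm (suc j) (trans (sym eq) x≈ε)) j≤N)
        (SubSum-resp-≈ (sym eq) (SubSum-resp-↭ (↭-sym (terms sm)) (full sm (suc j) j≤N)))
        where j≤N = subst (suc j ≤_) sum-p j≤

  -- Counting subsequence sums when equality is decidable.

  module _ (_≟_ : Decidable _≈_) where
    open Membership setoid using (_∈_)
    open Unique setoid using (Unique)

    private
      decSetoid : DecSetoid c ℓ
      decSetoid = record { isDecEquivalence = record { isEquivalence = isEquivalence ; _≟_ = _≟_ } }

    subsums : List Carrier → List Carrier
    subsums []      = [ ε ]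
    subsums (a ∷ T) = subsums T ++ map (a ∙_) (subsums T)

    support : List Carrier → List Carrier
    support T = deduplicate _≟_ (subsums T)

    ∈-subsums⁺ : ∀ {T x} → SubSum T x → x ∈ subsums T
    ∈-subsums⁺ (empty x≈ε) = here x≈ε
    ∈-subsums⁺ (skip p)    = Any.++⁺ˡ (∈-subsums⁺ p)
    ∈-subsums⁺ {_ ∷ T} (take p x≈) =
      Any.++⁺ʳ (subsums T) (Any.map⁺ (Any.map (λ e → trans x≈ (∙-congˡ e)) (∈-subsums⁺ p)))

    ∈-subsums⁻ : ∀ T {x} → x ∈ subsums T → SubSum T x
    ∈-subsums⁻ []      (here x≈ε) = empty x≈ε
    ∈-subsums⁻ (a ∷ T) x∈ with Any.++⁻ (subsums T) x∈
    ... | inj₁ x∈ˡ = skip (∈-subsums⁻ T x∈ˡ)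
    ... | inj₂ x∈ʳ with Membership.find setoid (Any.map⁻ x∈ʳ)
    ...   | y , y∈ , x≈ = take (∈-subsums⁻ T y∈) x≈

    ∈-support⁺ : ∀ {T x} → SubSum T x → x ∈ support T
    ∈-support⁺ p =
      MembershipProperties.∈-deduplicate⁺ setoid _≟_ (λ y≈z e → trans e (sym y≈z)) (∈-subsums⁺ p)

    ∈-support⁻ : ∀ T {x} → x ∈ support T → SubSum T x
    ∈-support⁻ T x∈ = ∈-subsums⁻ T (MembershipProperties.∈-deduplicate⁻ setoid _≟_ (subsums T) x∈)

    support-! : ∀ T → Unique (support T)
    support-! T = DecUnique.deduplicate-! decSetoid (subsums T)

    support-SubSum : ∀ T → All (SubSum T) (support T)
    support-SubSum T = All.tabulateₛ setoid (∈-support⁻ T)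

    SubSum? : ∀ T x → Dec (SubSum T x)
    SubSum? T x = map′ (∈-support⁻ T) ∈-support⁺ (any? (x ≟_) (support T))

    -- This is |Σ₀(T)|, with the empty sum counted and repetitions discarded.
    card : List Carrier → ℕ
    card T = length (support T)

    length≤card : ∀ {T xs} → Unique xs → All (SubSum T) xs → length xs ≤ card T
    length≤card {T} xs! ps = Unique-length-≤ setoid (support T) xs! (All.map ∈-support⁺ ps)

    card-mono : ∀ {T U} → (∀ {x} → SubSum T x → SubSum U x) → card T ≤ card U
    card-mono {T} T⊆U = length≤card (support-! T) (All.map T⊆U (support-SubSum T))

    new∷support-! : ∀ {T x} → ¬ SubSum T x → Unique (x ∷ support T)
    new∷support-! {T} x∉ =
      All.map (λ p x≈y → x∉ (SubSum-resp-≈ (sym x≈y) p)) (support-SubSum T) ∷ support-! T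

    -- The empty sequence has one sum, and each further term contributes at least the new total.
    length<card : ∀ {T} → ZeroSumFree T → length T < card T
    length<card []                 = length≤card ([] ∷ []) (SubSum-ε [] ∷ [])
    length<card {a ∷ T} zf@(_ ∷ zf′) = ≤-trans (s≤s (length<card zf′))
      (length≤card (new∷support-! (total-new zf)) (SubSum-total (a ∷ T) ∷ All.map skip (support-SubSum T)))

    -- The total is already one new sum; a second one would raise the count by 2.
    gain≤1 : ∀ {a T x} → ZeroSumFree (a ∷ T) → card (a ∷ T) < 2 + card T →
             SubSum (a ∷ T) x → ¬ SubSum T x → x ≈ total (a ∷ T)
    gain≤1 {a} {T} {x} zf card< p x∉ with x ≟ total (a ∷ T)
    ... | yes x≈ = x≈
    ... | no x≉  = contradiction card< (≤⇒≯ (length≤card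
      ((x≉ ∷ All.map (λ q x≈y → x∉ (SubSum-resp-≈ (sym x≈y) q)) (support-SubSum T))
        ∷ new∷support-! (total-new zf))
      (p ∷ SubSum-total (a ∷ T) ∷ All.map skip (support-SubSum T))))

    total-↭ : ∀ {T U} → T ↭ₛ U → total T ≈ total U
    total-↭ = PermutationProperties.foldr-commMonoid setoid isCommutativeMonoid

    -- y ↦ σ − a − y and y ↦ σ − b − y preserve B = Σ₀(U) = Σ₀(V), so translation by a − b does as well.
    gains≤1⇒≈ : ∀ {T a b U V} → ZeroSumFree T → T ↭ₛ a ∷ U → T ↭ₛ b ∷ V →
                card T < 2 + card U → card T < 2 + card V → a ≈ b
    gains≤1⇒≈ {T} {a} {b} {U} {V} zf T↭a∷U T↭b∷V card<U card<V = a≈b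
      where
      open SetoidReasoning setoid

      zf-a = ZeroSumFree-resp-↭ T↭a∷U zf
      zf-b = ZeroSumFree-resp-↭ T↭b∷V zf

      a∷U⇒b∷V : ∀ {x} → SubSum (a ∷ U) x → SubSum (b ∷ V) x
      a∷U⇒b∷V = SubSum-resp-↭ (↭-trans (↭-sym T↭a∷U) T↭b∷V)

      b∷V⇒a∷U : ∀ {x} → SubSum (b ∷ V) x → SubSum (a ∷ U) x
      b∷V⇒a∷U = SubSum-resp-↭ (↭-trans (↭-sym T↭b∷V) T↭a∷U)

      same-total : total (a ∷ U) ≈ total (b ∷ V)
      same-total = trans (sym (total-↭ T↭a∷U)) (total-↭ T↭b∷V)

      gain-a : ∀ {x} → SubSum (a ∷ U) x → ¬ SubSum U x → x ≈ total (a ∷ U)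
      gain-a = gain≤1 zf-a (≤-<-trans (card-mono (SubSum-resp-↭ (↭-sym T↭a∷U))) card<U)

      gain-b : ∀ {x} → SubSum (b ∷ V) x → ¬ SubSum V x → x ≈ total (b ∷ V)
      gain-b = gain≤1 zf-b (≤-<-trans (card-mono (SubSum-resp-↭ (↭-sym T↭b∷V))) card<V)

      -- The only sum over T missing from Σ₀(V) is σ(T), and σ(T) is not in Σ₀(U) either.
      U⇒V : ∀ {x} → SubSum U x → SubSum V x
      U⇒V {x} p with SubSum? V x
      ... | yes q = q
      ... | no ¬q = contradiction
        (SubSum-resp-≈ (trans (gain-b (a∷U⇒b∷V (skip p)) ¬q) (sym same-total)) p) (total-new zf-a)

      V⇒U : ∀ {x} → SubSum V x → SubSum U x
      V⇒U {x} p with SubSum? U x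
      ... | yes q = q
      ... | no ¬q = contradiction
        (SubSum-resp-≈ (trans (gain-a (b∷V⇒a∷U (skip p)) ¬q) same-total) p) (total-new zf-b)

      translate : ∀ {y} → SubSum U y → ∃ λ z → SubSum U z × a ∙ y ≈ b ∙ z
      translate {y} p with SubSum-complement p
      ... | y′ , p′ , yy′≈ with SubSum-complement (U⇒V p′)
      ...   | z , q , y′z≈ = z , V⇒U q , ∙-cancelˡ y′ _ _ (begin
        y′ ∙ (a ∙ y)  ≈⟨ x∙yz≈y∙xz y′ a y ⟩
        a ∙ (y′ ∙ y)  ≈⟨ ∙-congˡ (trans (comm y′ y) yy′≈) ⟩
        total (a ∷ U) ≈⟨ same-total ⟩
        total (b ∷ V) ≈⟨ ∙-congˡ y′z≈ ⟨
        b ∙ (y′ ∙ z)  ≈⟨ x∙yz≈y∙xz y′ b z ⟨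
        y′ ∙ (b ∙ z)  ∎)

      -- Otherwise translation by a - b would send b + σ(U) to a + σ(U), which is no sum over U.
      b∙total∉U : ¬ SubSum U (b ∙ total U)
      b∙total∉U p with translate p
      ... | z , q , eq = total-new zf-a
        (SubSum-resp-≈ (sym (∙-cancelˡ b _ _ (trans (x∙yz≈y∙xz b a (total U)) eq))) q)

      -- As a sum over b ∷ V that is not in Σ₀(U), the element b + σ(U) can only be a + σ(U).
      a≈b : a ≈ b
      a≈b = sym (∙-cancelˡ (total U) _ _ (trans (comm _ _)
        (trans (gain-a (b∷V⇒a∷U (take (U⇒V (SubSum-total U)) ≈-refl)) b∙total∉U) (comm _ _))))

    -- The coefficients tried for `a` are the numbers `suc x`, from 1 to N + 1. If none fits, the N
    -- + 1 multiples of g and their translates by `a` are 2(N + 1) distinct sums, and N is at least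
    -- the length of T.
    extend : ∀ {g a T} → ZeroSumFree (a ∷ T) → UnsortedSmooth g T →
             card (a ∷ T) < 2 * length (a ∷ T) → UnsortedSmooth g (a ∷ T)
    extend {g} {a} {T} zf@(a∙y≉ε ∷ _) sm card< with anyUpTo? (λ x → a ≟ (suc x · g)) (suc (sum (ns sm)))
    ... | yes (x , x< , a≈) = UnsortedSmooth-∷ sm zf (s≤s z≤n) x< a≈
    ... | no a≉ = contradiction card< (≤⇒≯ (begin
      2 * suc (length T)                 ≤⟨ *-monoʳ-≤ 2 (s≤s (length≤sum sm)) ⟩
      2 * suc N                          ≡⟨ cong (_+_ (suc N)) (+-identityʳ (suc N)) ⟩
      suc N + suc N                      ≡⟨ ≡.cong₂ _+_ (length-applyUpTo (_· g) (suc N))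
                                              (length-applyUpTo (λ j → a ∙ j · g) (suc N)) ⟨
      length multiples + length shifted  ≡⟨ length-++ multiples ⟨
      length (multiples ++ shifted)      ≤⟨ length≤card unique (All.++⁺
                                              (All.applyUpTo⁺₁ (_· g) (suc N) (skip ∘ multiple))
                                              (All.applyUpTo⁺₁ (λ j → a ∙ j · g) (suc N)
                                                λ j< → take (multiple j<) ≈-refl)) ⟩
      card (a ∷ T)                       ∎))
      where
      open ≤-Reasoning
      N = sum (ns sm)

      multiples shifted : List Carrier
      multiples = applyUpTo (_· g) (suc N)
      shifted   = applyUpTo (λ j → a ∙ j · g) (suc N)

      multiple : ∀ {j} → j < suc N → SubSum T (j · g)
      multiple {j} j< = SubSum-resp-↭ (↭-sym (terms sm)) (full sm j (s≤s⁻¹ j<))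

      distinct : ∀ {i j} → i < j → j < suc N → ¬ i · g ≈ j · g
      distinct {i} {j} i<j j< eq = <⇒≱ (sum<ord sm (j ∸ i) {{>-nonZero (m<n⇒0<n∸m i<j)}}
        (identityʳ-unique _ _ (sym (trans eq (·-split g (<⇒≤ i<j)))))) (≤-trans (m∸n≤m j i) (s≤s⁻¹ j<))

      -- From a + jg = ig follows a = (i - j)g if j < i, a coefficient already tried; otherwise a +
      -- (j - i)g = 0 is a forbidden zero sum.
      a∙-disjoint : ∀ {i j} → i < suc N → j < suc N → ¬ a ∙ j · g ≈ i · g
      a∙-disjoint {i} {j} i< j< eq with j <? i
      ... | yes j<i with i ∸ j | m<n⇒0<n∸m j<i | m∸n≤m i j | ·-split g (<⇒≤ j<i)
      ...   | suc x | _ | x≤i | split = a≉ (x , ≤-trans x≤i (<⇒≤ i<) ,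
        ∙-cancelˡ (j · g) _ _ (trans (comm _ _) (trans eq split)))
      a∙-disjoint {i} {j} i< j< eq | no j≮i =
        a∙y≉ε (multiple (≤-<-trans (m∸n≤m j i) j<)) (identityʳ-unique (i · g) _
          (trans (x∙yz≈y∙xz _ _ _) (trans (∙-congˡ (sym (·-split g (≮⇒≥ j≮i)))) eq)))

      unique : Unique (multiples ++ shifted)
      unique = UniqueProperties.++⁺ setoid
        (UniqueProperties.applyUpTo⁺₁ setoid _ (suc N) distinct)
        (UniqueProperties.applyUpTo⁺₁ setoid _ (suc N) λ i<j j< eq → distinct i<j j< (∙-cancelˡ a _ _ eq))
        λ { (x∈ , x∈′) → case Any.applyUpTo⁻ _ x∈ of λ { (i , i< , x≈) →
            case Any.applyUpTo⁻ _ x∈′ of λ { (j , j< , x≈′) → a∙-disjoint i< j< (trans (sym x≈′) x≈) } } }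

    few-sums⇒smooth : ∀ T → ZeroSumFree T → card T < 2 * length T → ∃ λ g → UnsortedSmooth g T
    few-sums⇒smooth T = go (length T) T refl
      where
      go : ∀ m T → length T ≡ m → ZeroSumFree T → card T < 2 * length T → ∃ λ g → UnsortedSmooth g T
      go zero    []        _   _  ()
      go (suc m) T@(t ∷ _) |T| zf card<
        with Fin.any? (λ i → card (removeAt T i) <? 2 * length (removeAt T i))
      ... | yes (i , card<′) = case go m (removeAt T i) |T′| zf′ card<′ of λ where
            (g , sm) → g , UnsortedSmooth-resp-↭ (↭-sym T↭) (extend (zf′ᵢ) sm card<″)
        where
        T↭ = ↭-removeAt setoid T i
        |T|≡ = PermutationProperties.xs↭ys⇒|xs|≡|ys| setoid T↭
        |T′| = suc-injective (≡.trans (≡.sym |T|≡) |T|)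
        zf′ᵢ = ZeroSumFree-resp-↭ T↭ zf
        zf′ = case zf′ᵢ of λ { (_ ∷ z) → z }
        card<″ = ≤-<-trans (card-mono (SubSum-resp-↭ (↭-sym T↭)))
          (subst (λ l → card T < 2 * l) |T|≡ card<)
      -- Each deletion loses just one sum here, so every term equals the first one, `t`, which
      -- serves as g with all coefficients 1.
      ... | no none = t , constant⇒UnsortedSmooth (lookup⁻ T λ i →
            gains≤1⇒≈ zf (↭-removeAt setoid T i) (↭-removeAt setoid T zero) (small i) (small zero)) zf
        where
        -- Here 2|T| is 2 plus twice the length after the deletion, which is at most 2 plus the
        -- number of sums after it.
        small : ∀ i → card T < 2 + card (removeAt T i)
        small i = ≤-trans (subst (λ l → card T < 2 * l)
            (PermutationProperties.xs↭ys⇒|xs|≡|ys| setoid (↭-removeAt setoid T i)) card<)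
          (subst (_≤ 2 + card (removeAt T i)) (≡.sym (*-suc 2 _)) (s≤s (s≤s (≮⇒≥ λ p → none (i , p)))))

        lookup⁻ : ∀ {p} {P : Carrier → Set p} xs → (∀ i → P (lookup xs i)) → All P xs
        lookup⁻ []       f = []
        lookup⁻ (x ∷ xs) f = f zero ∷ lookup⁻ xs (f ∘ suc)

    -- Terms are sorted in greedily. If -w(a) is not a sum over `V`, then `a` can join `V`;
    -- otherwise `a` moves to `U` together with terms of `V` that sum to -w(a), and what is left of
    -- `V` stays zero-sum free.
    zero-sum-split : (w : I → Carrier) (T : List I) →
                     ∃ λ U → ∃ λ V → T ↭ U ++ V × total (map w U) ≈ ε × ZeroSumFree (map w V)
    zero-sum-split w []      = [] , [] , ↭.refl , ≈-refl , []
    zero-sum-split w (a ∷ T) with zero-sum-split w T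
    ... | U , V , T↭ , total≈ε , zf with SubSum? (map w V) (w a ⁻¹)
    ...   | no ∉ = U , a ∷ V , ↭.trans (↭.prep a T↭) (↭.↭-sym (↭.shift a U V)) , total≈ε ,
      ((λ p eq → ∉ (SubSum-resp-≈ (inverseʳ-unique _ _ eq) p)) ∷ zf)
    ...   | yes p with SubSum-split w V p
    ...     | V₁ , V₂ , V↭ , eq = a ∷ V₁ ++ U , V₂ , ↭.prep a T↭V₁UV₂ , aV₁U≈ε ,
      ZeroSumFree-++ʳ (map w V₁)
        (≡.subst ZeroSumFree (map-++ w V₁ V₂) (ZeroSumFree-resp-↭ (map-↭ setoid V↭) zf))
      where
      T↭V₁UV₂ : T ↭ (V₁ ++ U) ++ V₂
      T↭V₁UV₂ = ↭.trans T↭ (↭.trans (↭.++⁺ˡ U V↭)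
        (↭.trans (↭.shifts U V₁) (↭.↭-sym (↭.++-assoc V₁ U V₂))))

      aV₁U≈ε : total (map w (a ∷ V₁ ++ U)) ≈ ε
      aV₁U≈ε = begin
        w a ∙ total (map w (V₁ ++ U))                ≡⟨ cong (λ W → w a ∙ total W) (map-++ w V₁ U) ⟩
        w a ∙ total (map w V₁ ++ map w U)            ≈⟨ ∙-congˡ (total-++ (map w V₁) (map w U)) ⟩
        w a ∙ (total (map w V₁) ∙ total (map w U))   ≈⟨ ∙-congˡ (∙-cong eq total≈ε) ⟩
        w a ∙ (w a ⁻¹ ∙ ε)                           ≈⟨ ∙-congˡ (identityʳ (w a ⁻¹)) ⟩
        w a ∙ w a ⁻¹                                 ≈⟨ inverseʳ (w a) ⟩
        ε                                            ∎
        where open SetoidReasoning setoid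

-- Natural-number weights and 1-smooth sequences of integers.

·1≡+ : ∀ t → GroupSequences._·_ ℤ-group t 1ℤ ≡ + t
·1≡+ zero    = refl
·1≡+ (suc t) = cong (ℤ._+_ 1ℤ) (·1≡+ t)

total-+ : (w : I → ℕ) (T : List I) → SubsequenceSums.total ℤ-group (map (+_ ∘ w) T) ≡ + sum (map w T)
total-+ w []      = refl
total-+ w (a ∷ T) = cong (ℤ._+_ (+ w a)) (total-+ w T)

module Integers where
  open GroupSequences ℤ-group using (Smooth)
  open SubsequenceSums ℤ-group

  map-·1 : (w : I → ℕ) (T : List I) → map (λ t → GroupSequences._·_ ℤ-group t 1ℤ) (map w T) ≡ map (+_ ∘ w) T
  map-·1 w T = ≡.trans (≡.sym (map-∘ T)) (map-cong (λ a → ·1≡+ (w a)) T)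

  module _ (w : I → ℕ) (w≥1 : ∀ a → 1 ≤ w a) where

    positive-weights : ∀ T → All (1 ≤_) (map w T)
    positive-weights T = All.map⁺ (All.universal w≥1 T)

    short⇒Full-weights : ∀ T → sum (map w T) < 2 * length T → Full 1ℤ (map w T)
    short⇒Full-weights T sum< = short⇒Full (map w T) (positive-weights T)
      (subst (λ l → sum (map w T) < 2 * l) (≡.sym (length-map w T)) sum<)

    short⇒SubSum : ∀ T {j} → sum (map w T) < 2 * length T → j ≤ sum (map w T) →
                   SubSum (map (+_ ∘ w) T) (+ j)
    short⇒SubSum T {j} sum< j≤ = ≡.subst₂ SubSum (map-·1 w T) (·1≡+ j) (short⇒Full-weights T sum< j j≤)

    short⇒Smooth : ∀ T → sum (map w T) < 2 * length T → Smooth 1ℤ (map (+_ ∘ w) T)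
    short⇒Smooth T sum< = UnsortedSmooth⇒Smooth zf 0<|T| record
      { ns       = map w T
      ; positive = positive-weights T
      ; terms    = Permutation.↭-reflexive (≡.setoid ℤ) (≡.sym (map-·1 w T))
      -- The generator 1 has infinite order, so no positive multiple of it vanishes.
      ; sum<ord  = λ { (suc t) eq → case ≡.trans (≡.sym (·1≡+ (suc t))) eq of λ () }
      ; full     = short⇒Full-weights T sum<
      }
      where
      zf : ZeroSumFree (map (+_ ∘ w) T)
      zf = ZeroSumFree⁺ (+_ ∘ w) T λ a U _ eq →
        <⇒≢ (≤-trans (w≥1 a) (m≤m+n _ _)) (≡.sym (ℤ.+-injective (≡.trans (≡.sym (total-+ w (a ∷ U))) eq)))

      0<|T| : 0 < length (map (+_ ∘ w) T)
      0<|T| = subst (0 <_) (≡.sym (length-map _ T)) (*-cancelˡ-< 2 0 (length T) (≤-<-trans z≤n sum<))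

-- Sequences of residues modulo n.

module Residues (n : ℕ) .{{_ : NonZero n}} where
  open AbelianGroup (ℤ/ n ℤ) using (_≈_; ε; setoid; commutativeSemigroup) renaming (sym to ≈-sym)
  open SemigroupSequences commutativeSemigroup using (sum⁺)
  open GroupSequences (ℤ/ n ℤ)
  open SubsequenceSums (ℤ/ n ℤ)
  open SubsequenceSums.UnsortedSmooth

  _≈?_ : Decidable _≈_
  x ≈? y = + n ℤ∣.∣? (x ℤ.- y)

  ≈ε⇒∣ : ∀ {x} → x ≈ ε → n ∣ ℤ.∣ x ∣
  ≈ε⇒∣ {x} x≈ε = subst (λ y → n ∣ ℤ.∣ y ∣) (ℤ.+-identityʳ x) (ℤ∣.∣⇒∣ᵤ x≈ε)

  ∣⇒≈ε : ∀ {x} → n ∣ ℤ.∣ x ∣ → x ≈ ε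
  ∣⇒≈ε {x} n∣x = ℤ∣.∣ᵤ⇒∣ (subst (λ y → n ∣ ℤ.∣ y ∣) (≡.sym (ℤ.+-identityʳ x)) n∣x)

  card≤n : ∀ T → card _≈?_ T ≤ n
  card≤n T = subst (card _≈?_ T ≤_) (length-applyUpTo +_ n)
    (Unique-length-≤ setoid (applyUpTo +_ n) (support-! _≈?_ T) (All.universal (λ x →
      Any.applyUpTo⁺ +_ (≈-residue x) (n%ℕd<d x n)) _))
    where
    ≈-residue : ∀ x → x ≈ + (x %ℕ n)
    ≈-residue x = ℤ∣.divides q (begin
      x ℤ.- r                    ≡⟨ cong (λ y → y ℤ.- r) (a≡a%ℕn+[a/ℕn]*n x n) ⟩
      r ℤ.+ q ℤ.* + n ℤ.- r      ≡⟨ cong (λ y → y ℤ.- r) (ℤ.+-comm r (q ℤ.* + n)) ⟩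
      q ℤ.* + n ℤ.+ r ℤ.- r      ≡⟨ ℤ.+-assoc (q ℤ.* + n) r (ℤ.- r) ⟩
      q ℤ.* + n ℤ.+ (r ℤ.- r)    ≡⟨ cong (ℤ._+_ (q ℤ.* + n)) (ℤ.+-inverseʳ r) ⟩
      q ℤ.* + n ℤ.+ + 0          ≡⟨ ℤ.+-identityʳ (q ℤ.* + n) ⟩
      q ℤ.* + n                  ∎)
      where
      open ≡.≡-Reasoning
      q = x /ℕ n
      r = + (x %ℕ n)

  ∣·∣ : ∀ t g → ℤ.∣ t · g ∣ ≡ t * ℤ.∣ g ∣
  ∣·∣ t g = ≡.trans (cong ℤ.∣_∣ (·≡* t)) (ℤ.abs-* (+ t) g)
    where
    ·≡* : ∀ t → t · g ≡ + t ℤ.* g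
    ·≡* zero    = ≡.sym (ℤ.*-zeroˡ g)
    ·≡* (suc t) = ≡.trans (cong (ℤ._+_ g) (·≡* t)) (≡.sym (ℤ.suc-* (+ t) g))

  -- The order of g divides n and exceeds n / 2.
  HasOrder⁺ : ∀ {g N} → N <ord g → n ≤ 2 * N → HasOrder g n
  HasOrder⁺ {g} {N} N<ord n≤2N =
    ∣⇒≈ε {n · g} (subst (n ∣_) (≡.sym (∣·∣ n g)) (m∣m*n ℤ.∣ g ∣)) , order≥n
    where
    order≥n : ∀ t .{{_ : NonZero t}} → t · g ≈ ε → n ≤ t
    order≥n t t·g≈ε = ∣⇒≤ (subst (_∣ t) d≡n (gcd[m,n]∣n n t))
      where
      d = gcd n t
      m = ℤ.∣ g ∣

      instance
        d≢0 : NonZero d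
        d≢0 = ≢-nonZero (gcd[m,n]≢0 n t (inj₁ (≢-nonZero⁻¹ n)))

      -- As n divides both n|g| and t|g|, it divides gcd(n, t)|g|.
      d·g≈ε : d · g ≈ ε
      d·g≈ε = ∣⇒≈ε {d · g} (subst (n ∣_)
        (≡.trans (≡.sym (c*gcd[m,n]≡gcd[cm,cn] m n t)) (≡.trans (*-comm m d) (≡.sym (∣·∣ d g))))
        (gcd-greatest (n∣m*n m) (subst (n ∣_) (≡.trans (∣·∣ t g) (*-comm t m)) (≈ε⇒∣ {t · g} t·g≈ε))))

      n<2d : n < 2 * d
      n<2d = ≤-<-trans n≤2N (*-monoʳ-< 2 (N<ord d d·g≈ε))

      d≡n : d ≡ n
      d≡n with gcd[m,n]∣m n t
      ... | divides zero          n≡ = contradiction n≡ (≢-nonZero⁻¹ n)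
      ... | divides (suc zero)    n≡ = ≡.sym (≡.trans n≡ (+-identityʳ d))
      ... | divides (suc (suc q)) n≡ = contradiction n<2d
        (≤⇒≯ (≤-trans (*-monoˡ-≤ d (s≤s (s≤s (z≤n {q})))) (≤-reflexive (≡.sym n≡))))

  ∑≈ε⇒∣ : (w : I → ℕ) (T : List I) → total (map (+_ ∘ w) T) ≈ ε → n ∣ sum (map w T)
  ∑≈ε⇒∣ w T eq = ≈ε⇒∣ {+ sum (map w T)} (subst (_≈ ε) (total-+ w T) eq)

  long⇒smooth : ∀ T → ZeroSumFree T → n < 2 * length T → ∃ λ g → HasOrder g n × Smooth g T
  long⇒smooth T zf n<2|T| with few-sums⇒smooth _≈?_ T zf (≤-<-trans (card≤n T) n<2|T|)
  ... | g , sm = g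
    , HasOrder⁺ {g} (sum<ord sm) (≤-trans (<⇒≤ n<2|T|) (*-monoʳ-≤ 2 (length≤sum sm)))
    , UnsortedSmooth⇒Smooth zf (*-cancelˡ-< 2 0 _ (≤-<-trans z≤n n<2|T|)) sm

  -- A sum divisible by n is zero in ℤ/nℤ, so smoothness would give jg = 0 with 1 ≤ j ≤ N, although
  -- N is below the order of g.
  Smooth⇒∤ : ∀ (w : I → ℕ) {g T a U} → Smooth g (map (+_ ∘ w) T) → a ∷ U ⊆ T → ¬ n ∣ sum (map w (a ∷ U))
  Smooth⇒∤ w {g} {a = a} {U} smooth a∷U⊆T n∣ =
    case Equivalence.to (sums ε) (ws , ⊆.map⁺ (+_ ∘ w) a∷U⊆T , sum⁺≈ε) of λ where
      (j , 1≤j , j≤N , ε≈j·g) → <⇒≱ (N<ord j {{>-nonZero 1≤j}} (≈-sym {ε} {j · g} ε≈j·g)) j≤N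
    where
    open Smooth smooth
    open SetoidReasoning setoid

    ws = + w a List⁺.∷ map (+_ ∘ w) U

    sum⁺≈ε : sum⁺ ws ≈ ε
    sum⁺≈ε = begin
      sum⁺ ws                      ≈⟨ sum⁺≈total (+ w a) (map (+_ ∘ w) U) ⟩
      total (toList ws)            ≡⟨ total-+ w (a ∷ U) ⟩
      + sum (map w (a ∷ U))        ≈⟨ ∣⇒≈ε {+ sum (map w (a ∷ U))} n∣ ⟩
      ε                            ∎

  -- Distinct multiples of n are at least n apart.
  <-multiple : ∀ {m K} → n ∣ m → m < K * n → m + n ≤ K * n
  <-multiple {K = K} (divides-refl q) m<Kn = ≤-trans (≤-reflexive (+-comm (q * n) n))
    (*-monoˡ-≤ n (*-cancelʳ-< n q K m<Kn))

  module _ (w : I → ℕ) (w≥1 : ∀ a → 1 ≤ w a) (T : List I) (K : ℕ)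
           (multiples<Kn : ∀ {j} → SubsequenceSums.SubSum ℤ-group (map (+_ ∘ w) T) (+ j) →
                           n ∣ j → j < K * n)
           where
    private module ℤ⁺ = SubsequenceSums ℤ-group

    -- In place of removing a subsequence of `U` with sum `r`, its complement in `U`, of sum a - r,
    -- is joined with `V`. The resulting multiple of n is below Kn, hence at most Kn - n, and σ(T)
    -- exceeds it by only r < n.
    long⇒sum<Kn : K * n + n ≤ suc (2 * length T) → sum (map w T) < K * n
    long⇒sum<Kn Kn+n≤ with zero-sum-split _≈?_ (+_ ∘ w) T
    ... | U , V , T↭ , U≈ε , zf = begin-strict
      sum (map w T)               ≡⟨ sum-↭ (↭.map⁺ w T↭) ⟩
      sum (map w (U ++ V))        ≡⟨ cong sum (map-++ w U V) ⟩
      sum (map w U ++ map w V)    ≡⟨ sum-++ (map w U) (map w V) ⟩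
      a + b                       ≡⟨ cong (λ m → m + b) (m∸n+n≡m r≤a) ⟨
      a ∸ r + r + b               ≡⟨ +-assoc (a ∸ r) r b ⟩
      a ∸ r + (r + b)             ≡⟨ cong (_+_ (a ∸ r)) (+-comm r b) ⟩
      a ∸ r + (b + r)             ≡⟨ +-assoc (a ∸ r) b r ⟨
      a ∸ r + b + r               <⟨ +-monoʳ-< (a ∸ r + b) r<n ⟩
      a ∸ r + b + n               ≤⟨ <-multiple {K = K} n∣ (multiples<Kn SubSum-a∸r+b n∣) ⟩
      K * n                       ∎
      where
      open ≤-Reasoning

      a = sum (map w U)
      b = sum (map w V)
      r = b % n

      r<n : r < n
      r<n = m%n<n b n

      SubSum-UV : ∀ {i j} → ℤ⁺.SubSum (map (+_ ∘ w) U) (+ i) → ℤ⁺.SubSum (map (+_ ∘ w) V) (+ j) →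
                  ℤ⁺.SubSum (map (+_ ∘ w) T) (+ (i + j))
      SubSum-UV {i} {j} p q = ℤ⁺.SubSum-resp-↭ (map-↭ (≡.setoid ℤ) (↭.↭-sym T↭))
        (≡.subst (λ W → ℤ⁺.SubSum W (+ (i + j))) (≡.sym (map-++ (+_ ∘ w) U V)) (ℤ⁺.SubSum-++ p q))

      SubSum-b : ℤ⁺.SubSum (map (+_ ∘ w) V) (+ b)
      SubSum-b = ≡.subst (ℤ⁺.SubSum _) (total-+ w V) (ℤ⁺.SubSum-total _)

      n∣a : n ∣ a
      n∣a = ∑≈ε⇒∣ w U U≈ε

      a<Kn : a < K * n
      a<Kn = multiples<Kn (subst (λ m → ℤ⁺.SubSum (map (+_ ∘ w) T) (+ m)) (+-identityʳ a)
        (SubSum-UV (≡.subst (ℤ⁺.SubSum _) (total-+ w U) (ℤ⁺.SubSum-total _)) (ℤ⁺.SubSum-ε _))) n∣a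

      -- A zero-sum free sequence has more sums than terms, and only n residues are available.
      |V|<n : length V < n
      |V|<n = subst (_< n) (length-map _ V) (≤-trans (length<card _≈?_ zf) (card≤n (map (+_ ∘ w) V)))

      -- From a ≤ Kn - n and |V| + 1 ≤ n follows a + 2|V| + 2 ≤ Kn + n ≤ 2|T| + 1, and 2|V| + 1
      -- cancels.
      a<2|U| : a < 2 * length U
      a<2|U| = +-cancelʳ-≤ (suc (2 * length V)) (suc a) (2 * length U) (begin
        suc a + suc (2 * length V)           ≡⟨ +-suc (suc a) (2 * length V) ⟩
        2 + (a + 2 * length V)               ≡⟨ cong suc (+-suc a (2 * length V)) ⟨
        suc (a + suc (2 * length V))         ≡⟨ +-suc a (suc (2 * length V)) ⟨
        a + (2 + 2 * length V)               ≡⟨ cong (_+_ a) (*-suc 2 (length V)) ⟨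
        a + 2 * suc (length V)               ≤⟨ +-monoʳ-≤ a (*-monoʳ-≤ 2 |V|<n) ⟩
        a + 2 * n                            ≡⟨ cong (λ m → a + (n + m)) (+-identityʳ n) ⟩
        a + (n + n)                          ≡⟨ +-assoc a n n ⟨
        a + n + n                            ≤⟨ +-monoˡ-≤ n (<-multiple {K = K} n∣a a<Kn) ⟩
        K * n + n                            ≤⟨ Kn+n≤ ⟩
        suc (2 * length T)                   ≡⟨ cong (λ l → suc (2 * l)) (≡.trans (↭.↭-length T↭) (length-++ U)) ⟩
        suc (2 * (length U + length V))      ≡⟨ cong suc (*-distribˡ-+ 2 (length U) (length V)) ⟩
        suc (2 * length U + 2 * length V)    ≡⟨ +-suc (2 * length U) (2 * length V) ⟨
        2 * length U + suc (2 * length V)    ∎)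

      -- The strict bound just obtained makes `U` nonempty. So `a` is a positive multiple of n and
      -- leaves room for `r`.
      0<a : 0 < a
      0<a = ≤-trans (*-cancelˡ-< 2 0 (length U) (≤-<-trans z≤n a<2|U|))
        (subst (_≤ a) (length-map w U) (positive⇒length≤sum (Integers.positive-weights w w≥1 U)))

      r≤a : r ≤ a
      r≤a = ≤-trans (<⇒≤ r<n) (∣⇒≤ {{>-nonZero 0<a}} n∣a)

      n∣ : n ∣ a ∸ r + b
      n∣ = subst (n ∣_) (≡.sym (≡.trans (cong (_+_ (a ∸ r)) (m≡m%n+[m/n]*n b n))
             (≡.trans (≡.sym (+-assoc (a ∸ r) r _)) (cong (λ m → m + b / n * n) (m∸n+n≡m r≤a)))))
             (∣m∣n⇒∣m+n n∣a (n∣m*n (b / n)))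

      SubSum-a∸r+b : ℤ⁺.SubSum (map (+_ ∘ w) T) (+ (a ∸ r + b))
      SubSum-a∸r+b = SubSum-UV (Integers.short⇒SubSum w w≥1 U a<2|U| (m∸n≤m a r)) SubSum-b

sum-map-⊆ : (w : I → ℕ) {U T : List I} → U ⊆ T → sum (map w U) ≤ sum (map w T)
sum-map-⊆ w []           = z≤n
sum-map-⊆ w (a ∷ʳ U⊆T)   = ≤-trans (sum-map-⊆ w U⊆T) (m≤n+m _ (w a))
sum-map-⊆ w (refl ∷ U⊆T) = +-monoʳ-≤ _ (sum-map-⊆ w U⊆T)

-- Idempotents and index sums in a cyclic semigroup.

module CyclicSemigroups {c ℓ} {k′ n : ℕ} .{{_ : NonZero n}} (C : CyclicSemigroup c ℓ (suc k′) n) where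
  open CyclicSemigroup C renaming (refl to ≈-refl)
  open Algebra.Definitions _≈_ using (_IdempotentOn_)
  open SetoidReasoning setoid
  open import Algebra.Properties.CommutativeSemigroup +-commutativeSemigroup using (interchange; xy∙z≈xz∙y)

  private
    k = suc k′

  -- The shift by one makes every natural number admissible, without proofs of positivity; ks is
  -- then `power k′`.
  power : ℕ → Carrier
  power t = suc t · s

  power-+ : ∀ t u → power t ∙ power u ≈ power (t + suc u)
  power-+ zero    u = ≈-refl
  power-+ (suc t) u = trans (assoc s (power t) (power u)) (∙-congˡ (power-+ t u))

  power-shift : ∀ j t u → power t ≈ power u → power (t + j) ≈ power (u + j)
  power-shift j t u eq = ≡.subst₂ (λ x y → power x ≈ power y) (+-comm j t) (+-comm j u) (go j)
    where
    go : ∀ j → power (j + t) ≈ power (j + u)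
    go zero    = eq
    go (suc j) = ∙-congˡ (go j)

  -- From ks on, the multiples of s repeat with period n; `j` is the distance from ks.
  power-periods : ∀ q j → power (k′ + j + q * n) ≈ power (k′ + j)
  power-periods zero    j = reflexive (cong power (+-identityʳ (k′ + j)))
  power-periods (suc q) j = begin
    power (k′ + j + (n + q * n))   ≡⟨ cong power (interchange k′ j n (q * n)) ⟩
    power (k′ + n + (j + q * n))   ≈⟨ power-shift (j + q * n) (k′ + n) k′ (proj₁ period) ⟩
    power (k′ + (j + q * n))       ≡⟨ cong power (+-assoc k′ j (q * n)) ⟨
    power (k′ + j + q * n)         ≈⟨ power-periods q j ⟩
    power (k′ + j)                 ∎

  -- With M = m + 1, the equation 2Ms = Ms is a coincidence of two multiples, so k ≤ M. Shifted into
  -- the periodic part it gives (k + M)s = ks, and the minimality of n makes n divide M.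
  idempotent⇒ : ∀ m → _∙_ IdempotentOn power m → k ≤ suc m × n ∣ suc m
  idempotent⇒ m idem = proj₂ index (suc m) (suc (m + suc m) , _ , m+1+n≢m m ∘ suc-injective , sym 2m≈m)
                     , m%n≡0⇒n∣m (suc m) n (r≡0 ((suc m) % n) refl)
    where
    2m≈m : power (m + suc m) ≈ power m
    2m≈m = trans (sym (power-+ m m)) idem

    -- This shift takes m to k′ + mn, which lies m periods after k′; the difference is not truncated
    -- because m ≤ mn.
    x = k′ + m * n ∸ m

    m+x : m + x ≡ k′ + 0 + m * n
    m+x = ≡.trans (m+[n∸m]≡n (≤-trans (m≤m*n m n) (m≤n+m (m * n) k′)))
      (cong (λ a → a + m * n) (≡.sym (+-identityʳ k′)))

    m-period : power (k′ + suc m) ≈ power (k′ + 0)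
    m-period = begin
      power (k′ + suc m)               ≈⟨ power-periods m (suc m) ⟨
      power (k′ + suc m + m * n)       ≡⟨ cong power (xy∙z≈xz∙y k′ (suc m) (m * n)) ⟩
      power (k′ + m * n + suc m)       ≡⟨ cong (λ a → power (a + m * n + suc m)) (+-identityʳ k′) ⟨
      power (k′ + 0 + m * n + suc m)   ≡⟨ cong (λ a → power (a + suc m)) m+x ⟨
      power (m + x + suc m)            ≡⟨ cong power (xy∙z≈xz∙y m x (suc m)) ⟩
      power (m + suc m + x)            ≈⟨ power-shift x (m + suc m) m 2m≈m ⟩
      power (m + x)                    ≡⟨ cong power m+x ⟩
      power (k′ + 0 + m * n)           ≈⟨ power-periods m 0 ⟩
      power (k′ + 0)                   ∎

    -- A positive remainder would be a period shorter than n.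
    r≡0 : ∀ r → suc m % n ≡ r → suc m % n ≡ 0
    r≡0 zero    eq = eq
    r≡0 (suc r) eq = contradiction (proj₂ period (suc r) (begin
      power (k′ + suc r)                          ≈⟨ power-periods (suc m / n) (suc r) ⟨
      power (k′ + suc r + suc m / n * n)          ≡⟨ cong power (+-assoc k′ (suc r) _) ⟩
      power (k′ + (suc r + suc m / n * n))        ≡⟨ cong (λ a → power (k′ + (a + suc m / n * n))) eq ⟨
      power (k′ + (suc m % n + suc m / n * n))    ≡⟨ cong (λ a → power (k′ + a)) (m≡m%n+[m/n]*n (suc m) n) ⟨
      power (k′ + suc m)                          ≈⟨ m-period ⟩
      power (k′ + 0)                              ≡⟨ cong power (+-identityʳ k′) ⟩
      power k′                                    ∎)) (<⇒≱ (subst (_< n) eq (m%n<n (suc m) n)))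

  -- Doubling adds `suc m`, a whole number of periods, to a position that is already in the periodic
  -- part.
  idempotent⇐ : ∀ m → k ≤ suc m → n ∣ suc m → _∙_ IdempotentOn power m
  idempotent⇐ m k≤ (divides q eq) = begin
    power m ∙ power m               ≈⟨ power-+ m m ⟩
    power (m + suc m)               ≡⟨ ≡.cong₂ (λ a b → power (a + b)) (m+[n∸m]≡n (s≤s⁻¹ k≤)) (≡.sym eq) ⟨
    power (k′ + (m ∸ k′) + q * n)   ≈⟨ power-periods q (m ∸ k′) ⟩
    power (k′ + (m ∸ k′))           ≡⟨ cong power (m+[n∸m]≡n (s≤s⁻¹ k≤)) ⟩
    power m                         ∎

  ind-power : ∀ a → power (pred (ind C a)) ≈ a
  ind-power a = proj₁ (ind-least C a)

  ∑ind : List Carrier → ℕ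
  ∑ind T = sum (map (ind C) T)

  power-∑ind : ∀ a U → power (pred (∑ind (a ∷ U))) ≈ sum⁺ (a List⁺.∷ U)
  power-∑ind a []      = trans (reflexive (cong (λ t → power (pred t)) (+-identityʳ (ind C a)))) (ind-power a)
  power-∑ind a (b ∷ U) = trans (sym (power-+ (pred (ind C a)) _)) (∙-cong (ind-power a) (power-∑ind b U))

  -- Together with `IdempotentSumFree⇐` this turns the semigroup condition into arithmetic: a sum is
  -- the multiple of s given by its index sum, and is idempotent exactly when that index sum is at
  -- least k and divisible by n.
  IdempotentSumFree⇒ : ∀ {T a U} → IdempotentSumFree T → a ∷ U ⊆ T → k ≤ ∑ind (a ∷ U) →
                       ¬ n ∣ ∑ind (a ∷ U)
  IdempotentSumFree⇒ {a = a} {U} free a∷U⊆T k≤ n∣ =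
    free (power (pred (∑ind (a ∷ U)))) (a List⁺.∷ U , a∷U⊆T , sym (power-∑ind a U)) (idempotent⇐ _ k≤ n∣)

  IdempotentSumFree⇐ : ∀ {T} → (∀ a U → a ∷ U ⊆ T → k ≤ ∑ind (a ∷ U) → ¬ n ∣ ∑ind (a ∷ U)) →
                       IdempotentSumFree T
  IdempotentSumFree⇐ h x (a List⁺.∷ U , a∷U⊆T , eq) idem =
    let y≈x = trans (power-∑ind a U) eq
        k≤ , n∣ = idempotent⇒ _ (trans (∙-cong y≈x y≈x) (trans idem (sym y≈x)))
    in h a U a∷U⊆T k≤ n∣

-- Rounding and the length bound.

⌈/⌉-least : ∀ k n .{{_ : NonZero n}} {m} → k ≤ m → n ∣ m → ⌈ k / n ⌉ * n ≤ m
⌈/⌉-least k n k≤m (divides-refl q) = *-monoˡ-≤ n (s≤s⁻¹ (m<n*o⇒m/o<n {n = suc q} (begin-strict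
  k + (n ∸ 1)       ≤⟨ +-monoˡ-≤ (n ∸ 1) k≤m ⟩
  q * n + (n ∸ 1)   <⟨ +-monoʳ-< (q * n) (≤-reflexive (suc-pred n)) ⟩
  q * n + n         ≡⟨ +-comm (q * n) n ⟩
  suc q * n         ∎)))
  where open ≤-Reasoning

-- The floor loses at most n - 1, just what the ceiling has added. With `⌈/⌉-least`, the forbidden
-- index sums are thus the multiples of n from Kn on.
k≤⌈k/n⌉*n : ∀ k n .{{_ : NonZero n}} → k ≤ ⌈ k / n ⌉ * n
k≤⌈k/n⌉*n k n = +-cancelʳ-≤ (n ∸ 1) k _ (begin
  k + (n ∸ 1)                                        ≡⟨ m≡m%n+[m/n]*n (k + (n ∸ 1)) n ⟩
  (k + (n ∸ 1)) % n + (k + (n ∸ 1)) / n * n          ≤⟨ +-monoˡ-≤ _ (pred-mono-≤ (m%n<n (k + (n ∸ 1)) n)) ⟩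
  n ∸ 1 + (k + (n ∸ 1)) / n * n                      ≡⟨ +-comm (n ∸ 1) _ ⟩
  (k + (n ∸ 1)) / n * n + (n ∸ 1)                    ∎)
  where open ≤-Reasoning

m≤1+2[m/2] : ∀ m → m ≤ suc (2 * (m / 2))
m≤1+2[m/2] m = begin
  m                    ≡⟨ m≡m%n+[m/n]*n m 2 ⟩
  m % 2 + m / 2 * 2    ≤⟨ +-monoˡ-≤ _ (s≤s⁻¹ (m%n<n m 2)) ⟩
  suc (m / 2 * 2)      ≡⟨ cong suc (*-comm (m / 2) 2) ⟩
  suc (2 * (m / 2))    ∎
  where open ≤-Reasoning

minLength-> : ∀ {k n} .{{_ : NonZero n}} → n < k → minLength k n ≡ (⌈ k / n ⌉ + 1) * n / 2
minLength-> {k} {n} n<k rewrite dec-true (n <? k) n<k = refl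

minLength-≤ : ∀ {k n} .{{_ : NonZero n}} → k ≤ n → minLength k n ≡ n / 2 + 1
minLength-≤ {k} {n} k≤n rewrite dec-false (n <? k) (≤⇒≯ k≤n) = refl

theorem3p10 : ∀ {c ℓ : Level} (k n : ℕ) .{{_ : NonZero k}} .{{_ : NonZero n}}
    (C : CyclicSemigroup c ℓ k n) (T : List (CyclicSemigroup.Carrier C)) →
    length T ≥ minLength k n →
    CyclicSemigroup.IdempotentSumFree C T ⇔
    ( ( k > n
    × GroupSequences.Smooth ℤ-group 1ℤ (map (λ a → + ind C a) T)
    × sum (map (ind C) T) ≤ ⌈ k / n ⌉ * n ∸ 1 )
    ⊎ ( k ≤ n
    × ∃ λ (g : ℤ) →
    GroupSequences.HasOrder (ℤ/ n ℤ) g n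
    × GroupSequences.Smooth (ℤ/ n ℤ) g (map (λ a → + ind C a) T) ) )
theorem3p10 k@(suc k′) n C T |T|≥ = mk⇔ (to (n <? k)) (λ { (inj₁ p) → from-> p ; (inj₂ p) → from-≤ p })
  where
  open CyclicSemigroup C using (IdempotentSumFree)
  open CyclicSemigroups {k′ = k′} C
  open Residues n
  module ℤₙ = SubsequenceSums (ℤ/ n ℤ)
  module ℤ⁺ = SubsequenceSums ℤ-group

  w : CyclicSemigroup.Carrier C → ℤ
  w a = + ind C a

  K = ⌈ k / n ⌉

  0<Kn : 0 < K * n
  0<Kn = ≤-trans (s≤s z≤n) (k≤⌈k/n⌉*n k n)

  module _ (n<k : n < k) (free : IdempotentSumFree T) where

    multiples<Kn : ∀ {j} → ℤ⁺.SubSum (map w T) (+ j) → n ∣ j → j < K * n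
    multiples<Kn p n∣j with ℤ⁺.SubSum⇒⊆ w T p
    ... | U , U⊆T , eq with ≡.trans (≡.sym (total-+ (ind C) U)) eq
    ...   | refl = bound U U⊆T n∣j
      where
      -- Idempotent-sum freeness constrains nonempty subsequences; the empty one has sum 0 and is
      -- covered by 0 < Kn.
      bound : ∀ U → U ⊆ T → n ∣ ∑ind U → ∑ind U < K * n
      bound []      _     _  = 0<Kn
      bound (a ∷ U) a∷U⊆T n∣ =
        <-≤-trans (≰⇒> λ k≤ → IdempotentSumFree⇒ free a∷U⊆T k≤ n∣) (k≤⌈k/n⌉*n k n)

    -- The length bound cleared of its floor; the 1 on the right pays for a possible odd (K + 1)n.
    Kn+n≤ : K * n + n ≤ suc (2 * length T)
    Kn+n≤ = begin
      K * n + n                    ≡⟨ +-comm (K * n) n ⟩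
      suc K * n                    ≡⟨ cong (_* n) (+-comm 1 K) ⟩
      (K + 1) * n                  ≤⟨ m≤1+2[m/2] ((K + 1) * n) ⟩
      suc (2 * ((K + 1) * n / 2))  ≤⟨ s≤s (*-monoʳ-≤ 2 (subst (_≤ length T) (minLength-> n<k) |T|≥)) ⟩
      suc (2 * length T)           ∎
      where open ≤-Reasoning

    sum<Kn : ∑ind T < K * n
    sum<Kn = long⇒sum<Kn (ind C) (λ _ → s≤s z≤n) T K multiples<Kn Kn+n≤

    -- As n ≥ 1, the bound on Kn + n yields Kn ≤ 2|T|.
    sum<2|T| : ∑ind T < 2 * length T
    sum<2|T| = <-≤-trans sum<Kn (s≤s⁻¹ (begin
      suc (K * n)         ≡⟨ +-comm 1 (K * n) ⟩
      K * n + 1           ≤⟨ +-monoʳ-≤ (K * n) (>-nonZero⁻¹ n) ⟩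
      K * n + n           ≤⟨ Kn+n≤ ⟩
      suc (2 * length T)  ∎))
      where open ≤-Reasoning

    to-> : GroupSequences.Smooth ℤ-group 1ℤ (map w T) × ∑ind T ≤ K * n ∸ 1
    to-> = Integers.short⇒Smooth (ind C) (λ _ → s≤s z≤n) T sum<2|T| , <⇒≤pred sum<Kn

  module _ (k≤n : k ≤ n) (free : IdempotentSumFree T) where

    -- A positive multiple of n is at least n ≥ k here, so every zero sum modulo n comes from an
    -- idempotent sum.
    zf : ℤₙ.ZeroSumFree (map w T)
    zf = ℤₙ.ZeroSumFree⁺ w T λ a U a∷U⊆T eq →
      let n∣ = ∑≈ε⇒∣ (ind C) (a ∷ U) eq
      in IdempotentSumFree⇒ free a∷U⊆T (≤-trans k≤n (∣⇒≤ n∣)) n∣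

    n<2|T| : n < 2 * length (map w T)
    n<2|T| = begin-strict
      n                     <⟨ s≤s (m≤1+2[m/2] n) ⟩
      2 + 2 * (n / 2)       ≡⟨ *-suc 2 (n / 2) ⟨
      2 * suc (n / 2)       ≡⟨ cong (2 *_) (+-comm 1 (n / 2)) ⟩
      2 * (n / 2 + 1)       ≤⟨ *-monoʳ-≤ 2 (subst (_≤ length T) (minLength-≤ k≤n) |T|≥) ⟩
      2 * length T          ≡⟨ cong (2 *_) (length-map w T) ⟨
      2 * length (map w T)  ∎
      where open ≤-Reasoning

    to-≤ : ∃ λ g → GroupSequences.HasOrder (ℤ/ n ℤ) g n × GroupSequences.Smooth (ℤ/ n ℤ) g (map w T)
    to-≤ = long⇒smooth (map w T) zf n<2|T|

  to : Dec (n < k) → IdempotentSumFree T → _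
  to (yes n<k) free = inj₁ (n<k , to-> n<k free)
  to (no n≮k)  free = inj₂ (≮⇒≥ n≮k , to-≤ (≮⇒≥ n≮k) free)

  from-> : k > n × _ × sum (map (ind C) T) ≤ K * n ∸ 1 → IdempotentSumFree T
  -- A forbidden index sum is at least Kn, but even the index sum of T is at most Kn - 1. With
  -- `o = 0` the monotonicity lemma reads Kn - 1 < Kn.
  from-> (_ , _ , sum≤) = IdempotentSumFree⇐ λ a U a∷U⊆T k≤ n∣ → <⇒≱ (∸-monoʳ-< {o = 0} (s≤s z≤n) 0<Kn)
    (≤-trans (⌈/⌉-least k n k≤ n∣) (≤-trans (sum-map-⊆ (ind C) a∷U⊆T) sum≤))

  from-≤ : k ≤ n × (∃ λ g → GroupSequences.HasOrder (ℤ/ n ℤ) g n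
                          × GroupSequences.Smooth (ℤ/ n ℤ) g (map w T)) →
           IdempotentSumFree T
  from-≤ (_ , _ , _ , smooth) = IdempotentSumFree⇐ λ a U a∷U⊆T _ → Smooth⇒∤ (ind C) smooth a∷U⊆T
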